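{- Assume the $abc$-conjecture: for every $\epsilon>0$ there is a constant $\kappa(\epsilon)>0$ such that whenever $a,b,c$ are coprime positive integers with $a+b=c$, one has $c<\kappa(\epsilon)\,\mathrm{Rad}(abc)^{1+\epsilon}$. Let $m\ge 3$ and $k\ge 2$ be integers. Then for every $\epsilon>0$ there is a constant $C>0$, depending only on $\epsilon,k,m$, such that for all positive integers $N,d$ for which each of $N, N+d, \ldots, N+(m-1)d$ is $k$-full, we have $$\gcd(d,N)\ \ge\ C\,(\max\{d,N\})^{\frac{m(1-1/k)-2}{m(1-1/k^2)-2}-\epsilon},$$ $$d\ \ge\ C\,N^{\frac{m(1-1/k)-1}{m(1-1/k^2)-1}-\epsilon},$$ $$N\ \ge\ C\,d^{\frac{m(1-1/k)+1/k-2}{m(1-1/k^2)+1/k-2}-\epsilon}.$$ If, further, $m\ge 2k-1$, then (again with $C>0$ depending only on $\epsilon,k,m$) the stronger inequalities $$\gcd(d,N)\ \ge\ C\,(\max\{d,N\})^{\frac{m(1-1/k)-2}{m(1-1/(2k-1))-2}-\epsilon},$$ $$d\ \ge\ C\,N^{\frac{m(1-1/k)-1}{m(1-1/(2k-1))-1}-\epsilon},$$ $$N\ \ge\ C\,d^{\frac{m(1-1/k)+1/k-2}{m(1-1/(2k-1))+1/k-2}-\epsilon}$$ hold.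
   Context: For an integer $k\ge 2$, a positive integer $n$ is called $k$-full if every prime $p$ dividing $n$ satisfies $p^k\mid n$. For a positive integer $n$, $\mathrm{Rad}(n)$ denotes the product of the distinct primes dividing $n$ (with $\mathrm{Rad}(1)=1$).
   Formalization: For k=2, m=3 the exponent in the stronger gcd inequality is (-1/2)/0, hence undefined; there the fraction is read as 0, so that this one inequality has exponent -ε and is trivial. All other cases are as stated. -}

module Defs where

open import Data.Nat using (ℕ; zero; suc; _+_; _*_; _^_; _≤_; _<_)
open import Data.Nat.Primality using (Prime; prime?)
open import Data.Nat.Divisibility using (_∣_; _∣?_)
import Data.Nat.GCD
open import Data.List using (List; filter; upTo)
open import Data.Nat.ListAction using (product)
open import Data.Integer using (ℤ; +_; -[1+_])
open import Data.Rational using (ℚ; mkℚ; ↥_; ↧ₙ_; _÷_; _/_; 0ℚ; 1ℚ) renaming (_+_ to _+ℚ_; _-_ to _-ℚ_; _*_ to _*ℚ_; _<_ to _<ℚ_)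
open import Data.Nat.Coprimality using (Coprime)
open import Data.Product using (∃; _×_)
open import Relation.Binary.PropositionalEquality using (_≡_)
open import Relation.Nullary.Decidable using (_×-dec_)

KFull : ℕ → ℕ → Set
KFull k n = (p : ℕ) → Prime p → p ∣ n → (p ^ k) ∣ n

-- Rad n = product of the distinct primes dividing n (primes p ≤ n suffice for n ≥ 1;
-- Rad 0 is junk and never used)
Rad : ℕ → ℕ
Rad n = product (filter (λ p → prime? p ×-dec (p ∣? n)) (upTo (suc n)))

ℕtoℚ : ℕ → ℚ
ℕtoℚ n = (+ n) / 1

-- 1/n as a rational (junk value 0 for n = 0, never used since n ≥ 1 below)
recip : ℕ → ℚ
recip zero    = 0ℚ
recip (suc n) = (+ 1) / suc n

-- total division of rationals (junk value 0 when dividing by 0)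
divQ : ℚ → ℚ → ℚ
divQ p (mkℚ (+ zero) _ _)        = 0ℚ
divQ p q@(mkℚ (+ suc n) _ _)     = p ÷ q
divQ p q@(mkℚ -[1+ n ] _ _)      = p ÷ q

posPart : ℤ → ℕ
posPart (+ n)      = n
posPart -[1+ n ]   = 0

negPart : ℤ → ℕ
negPart (+ n)      = 0
negPart -[1+ n ]   = suc n

-- For e = a/b in lowest terms (b ≥ 1), with positive reals x, y:
--   "x ≥ K^(-1/b) · y^e"   ⟺   y^a ≤ K · x^b   (a ≥ 0),  resp.  1 ≤ K · x^b · y^|a|  (a < 0).
-- Uniformly:  y^(a⁺) ≤ K · x^b · y^(a⁻).
-- Existence of a real constant C > 0 with x ≥ C·y^e is equivalent to existence of
-- a natural K with GeCPow K x y e (take C = K^(-1/b), resp. K = ⌈C^(-b)⌉).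
GeCPow : ℕ → ℕ → ℕ → ℚ → Set
GeCPow K x y e = y ^ posPart (↥ e) ≤ K * (x ^ ↧ₙ e) * (y ^ negPart (↥ e))

-- "c < K^(1/b) · R^e"  ⟺  c^b · R^(a⁻) < K · R^(a⁺)   for e = a/b in lowest terms.
-- Existence of real κ > 0 with c < κ·R^e ⟺ existence of natural K (K = ⌈κ^b⌉).
LtCPow : ℕ → ℕ → ℕ → ℚ → Set
LtCPow K c R e = (c ^ ↧ₙ e) * (R ^ negPart (↥ e)) < K * (R ^ posPart (↥ e))

-- The abc-conjecture: for every ε > 0 there is κ(ε) > 0 such that for coprime positive
-- integers a, b, c with a + b = c we have c < κ(ε) · Rad(abc)^(1+ε).
-- (ε ranges over positive rationals; this is equivalent to ranging over positive reals,
-- since the conclusion for ε implies it for every ε' ≥ ε as Rad(abc) ≥ 1.)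
ABC : Set
ABC = (ε : ℚ) → 0ℚ <ℚ ε →
      ∃ λ (K : ℕ) → (a b c : ℕ) → 1 ≤ a → 1 ≤ b → Coprime a b → a + b ≡ c →
      LtCPow K c (Rad (a * b * c)) (1ℚ +ℚ ε)

expGcd : ℚ → ℕ → ℕ → ℚ
expGcd s k m = divQ ((ℕtoℚ m *ℚ (1ℚ -ℚ recip k)) -ℚ ℕtoℚ 2) ((ℕtoℚ m *ℚ s) -ℚ ℕtoℚ 2)

expD : ℚ → ℕ → ℕ → ℚ
expD s k m = divQ ((ℕtoℚ m *ℚ (1ℚ -ℚ recip k)) -ℚ 1ℚ) ((ℕtoℚ m *ℚ s) -ℚ 1ℚ)

expN : ℚ → ℕ → ℕ → ℚ
expN s k m = divQ (((ℕtoℚ m *ℚ (1ℚ -ℚ recip k)) +ℚ recip k) -ℚ ℕtoℚ 2)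
                  (((ℕtoℚ m *ℚ s) +ℚ recip k) -ℚ ℕtoℚ 2)

s₁ : ℕ → ℚ
s₁ k = 1ℚ -ℚ recip (k * k)

s₂ : ℕ → ℚ
s₂ k = 1ℚ -ℚ recip ((k + k) Data.Nat.∸ 1)

-- The three lower bounds, with constant K (representing C = K^(-1/denominator)):
--   gcd(d,N) ≥ C·max(d,N)^(eg - ε),  d ≥ C·N^(ed - ε),  N ≥ C·d^(eN - ε)
Bounds : ℚ → ℕ → ℕ → ℚ → ℕ → ℕ → ℕ → Set
Bounds s k m ε K N d =
    GeCPow K (Data.Nat.GCD.gcd d N) (d Data.Nat.⊔ N) (expGcd s k m -ℚ ε)
  × GeCPow K d N (expD s k m -ℚ ε)
  × GeCPow K N d (expN s k m -ℚ ε)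

{-# OPTIONS --safe #-}

-- Write N = g x, d = g y with g = gcd(d, N), and let H = max(x, y), p = m - 1. The products A and B
-- of the powers (x + i y)^C(p, i) over even and over odd i are nearly coprime, and A - B = y^p G for a
-- form G of degree 2^(p-1) - p: this is the Belyi map of the points 0, -1, ..., -p, ramified to
-- order p at infinity. Any prime dividing a term x + i y has its k-th power dividing g Π (x + i y),
-- since it misses x or x + y. So abc applied to A, B, A - B gives, up to factors H^ε,
--   H^(k p) ≪ g x H^p y^k.
-- Using x, y ≤ H in three ways turns this into g ≫ M^(α/(α+1)), d ≫ M^(γ/(γ+1)) and N ≫ M^(δ/(δ+1))
-- for M = g H = max(d, N), where α, γ, δ are k times the numerators of the stated exponents
-- (or 0, where such a number is negative).
-- All stated exponents are at most these.
module Submission where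

open import Defs
open import Data.Nat using (ℕ; zero; suc; _+_; _*_; _∸_; _^_; _≤_; _<_; z≤n; s≤s; _⊔_; NonZero; >-nonZero; ≢-nonZero)
open import Data.Nat.Properties
open import Data.Nat.Divisibility
open import Data.Nat.GCD using (GCD; module Bézout; gcd; gcd[m,n]∣m; gcd[m,n]∣n; gcd[m,n]≢0; gcd-GCD; GCD-*)
open import Data.Nat.Primality using (Prime; prime?; euclidsLemma; ¬prime[1]; prime⇒irreducible)
open import Data.Nat.Coprimality as Coprimality using (Coprime; coprime-Bézout; coprime-divisor; GCD≡1⇒coprime; coprime-+; 1-coprimeTo)
open import Data.Nat.ListAction using (product)
open import Data.Nat.ListAction.Properties using (product-++; ∈⇒∣product)
import Data.Nat.Tactic.RingSolver as ℕSolver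
open import Data.Integer as ℤ using (ℤ; +_; -[1+_]; ∣_∣)
import Data.Integer.Properties as ℤ
import Data.Integer.Tactic.RingSolver as ℤSolver
open import Algebra.Properties.AbelianGroup ℤ.+-0-abelianGroup using (∙-cancelˡ; inverseˡ-unique)
open import Data.Rational as ℚ using (ℚ; mkℚ; 0ℚ; 1ℚ; ↥_; ↧_; *<*; *≤*; toℚᵘ) renaming (_+_ to _+ℚ_; _-_ to _-ℚ_; _*_ to _*ℚ_; _<_ to _<ℚ_; _≤_ to _≤ℚ_)
import Data.Rational.Properties as ℚ
open import Data.Rational.Solver using (module +-*-Solver)
import Data.Rational.Unnormalised as ℚᵘ
import Data.Rational.Unnormalised.Properties as ℚᵘ
open import Data.Bool using (Bool; true; false; not)
open import Data.List using (List; []; _∷_; _++_; map; length; upTo; applyUpTo)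
open import Data.List.Properties using (map-++; map-cong; map-∘; length-++; length-map; length-applyUpTo)
open import Data.List.Membership.Propositional.Properties using (∈-upTo⁺; ∈-map⁺)
open import Data.List.Relation.Unary.All as All using (All; []; _∷_)
import Data.List.Relation.Unary.All.Properties as All
open import Data.List.Relation.Unary.AllPairs using ([]; _∷_)
open import Data.List.Relation.Unary.Unique.Propositional using (Unique)
import Data.List.Relation.Unary.Unique.Propositional.Properties as Unique
open import Data.Product using (∃; ∃₂; _×_; _,_; proj₁; proj₂)
open import Data.Sum using (_⊎_; inj₁; inj₂)
open import Data.Empty using (⊥-elim)
open import Function using (_∘_; case_of_)
open import Relation.Nullary using (¬_; yes; no)
open import Relation.Nullary.Decidable using (_×-dec_)
open import Relation.Binary.Definitions using (tri<; tri≈; tri>)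
open import Relation.Binary.PropositionalEquality using (_≡_; _≢_; refl; sym; trans; cong; cong₂; subst; subst₂; module ≡-Reasoning)

-- Binary forms with integer coefficients

-- Why binomial multiplicities: log (A / B) is the alternating sum of C(p, i) log (x + i y), up to
-- sign a p-th finite difference of the logarithm, hence of order (y / x)^p. So y^p splits off from
-- A - B, yet it contributes only y to the radical. The obstacle is G, about whose primes nothing is
-- known. It enters the bound for the k-th power of the radical as G^k, of size at most H^(k E) up
-- to a constant, E being its degree. But the larger of A and B is at least H^(p + E), so H^(k E)
-- cancels exactly and the exponential degree leaves the main term. Near coprimality means that
-- common divisors divide a product of differences j - i of indices. Real exponents are avoided by
-- taking ε = 1/(n+1) in abc and clearing denominators; the spare factors keep a bounded exponent
-- while n grows, so they cost only an ε. Each stated exponent is a / b with b ≥ a + 1/k, for both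
-- kinds of denominator. With n ≥ k a this gives a / b ≤ n / (n + 1), so one estimate yields both
-- halves of the theorem.

data Form : ℕ → (ℕ → ℕ → ℤ) → Set where
  const : ∀ {f} c → (∀ x y → f x y ≡ c) → Form 0 f
  -- Horner's scheme in `x`. The equation is a field, so every pointwise equal function is again a
  -- form, without function extensionality.
  horner : ∀ {n f g} c → Form n g →
           (∀ x y → f x y ≡ + x ℤ.* g x y ℤ.+ c ℤ.* (+ y) ℤ.^ suc n) → Form (suc n) f

form-ext : ∀ {n f h} → Form n f → (∀ x y → h x y ≡ f x y) → Form n h
form-ext (const c e) q = const c λ x y → trans (q x y) (e x y)
form-ext (horner c F e) q = horner c F λ x y → trans (q x y) (e x y)

form-degree : ∀ {n m f} → n ≡ m → Form n f → Form m f
form-degree refl F = F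

form-+ : ∀ {n f h} → Form n f → Form n h → Form n (λ x y → f x y ℤ.+ h x y)
form-+ (const c e) (const c′ e′) = const (c ℤ.+ c′) λ x y → cong₂ ℤ._+_ (e x y) (e′ x y)
form-+ (horner {n} {g = g} c F e) (horner {g = g′} c′ F′ e′) =
  horner (c ℤ.+ c′) (form-+ F F′) λ x y →
    trans (cong₂ ℤ._+_ (e x y) (e′ x y)) (lem (+ x) (g x y) c ((+ y) ℤ.^ suc n) (g′ x y) c′)
  where
  lem : ∀ x g c p g′ c′ → (x ℤ.* g ℤ.+ c ℤ.* p) ℤ.+ (x ℤ.* g′ ℤ.+ c′ ℤ.* p)
                        ≡ x ℤ.* (g ℤ.+ g′) ℤ.+ (c ℤ.+ c′) ℤ.* p
  lem = ℤSolver.solve-∀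

form-scale : ∀ {n f} k → Form n f → Form n (λ x y → k ℤ.* f x y)
form-scale k (const c e) = const (k ℤ.* c) λ x y → cong (k ℤ.*_) (e x y)
form-scale k (horner {n} {g = g} c F e) = horner (k ℤ.* c) (form-scale k F) λ x y →
  trans (cong (k ℤ.*_) (e x y)) (lem k (+ x) (g x y) c ((+ y) ℤ.^ suc n))
  where
  lem : ∀ k x g c p → k ℤ.* (x ℤ.* g ℤ.+ c ℤ.* p) ≡ x ℤ.* (k ℤ.* g) ℤ.+ (k ℤ.* c) ℤ.* p
  lem = ℤSolver.solve-∀

form-x* : ∀ {n f} → Form n f → Form (suc n) (λ x y → + x ℤ.* f x y)
form-x* F = horner (+ 0) F λ x y → sym (ℤ.+-identityʳ _)

form-y* : ∀ {n f} → Form n f → Form (suc n) (λ x y → + y ℤ.* f x y)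
form-y* (const c e) = horner c (const (+ 0) λ _ _ → refl) λ x y →
  trans (cong (+ y ℤ.*_) (e x y)) (lem (+ x) (+ y) c)
  where
  lem : ∀ x y c → y ℤ.* c ≡ x ℤ.* (+ 0) ℤ.+ c ℤ.* (y ℤ.* + 1)
  lem = ℤSolver.solve-∀
form-y* (horner {n} {g = g} c F e) = horner c (form-y* F) λ x y →
  trans (cong (+ y ℤ.*_) (e x y)) (lem (+ x) (+ y) (g x y) c ((+ y) ℤ.^ n))
  where
  lem : ∀ x y g c p → y ℤ.* (x ℤ.* g ℤ.+ c ℤ.* (y ℤ.* p)) ≡ x ℤ.* (y ℤ.* g) ℤ.+ c ℤ.* (y ℤ.* (y ℤ.* p))
  lem = ℤSolver.solve-∀

form-y^* : ∀ j {n f} → Form n f → Form (j + n) (λ x y → (+ y) ℤ.^ j ℤ.* f x y)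
form-y^* zero F = form-ext F λ x y → ℤ.*-identityˡ _
form-y^* (suc j) F = form-ext (form-y* (form-y^* j F)) λ x y → ℤ.*-assoc (+ y) _ _

form-y^ : ∀ n c → Form n (λ x y → c ℤ.* (+ y) ℤ.^ n)
form-y^ n c = form-degree (+-identityʳ n)
  (form-ext (form-y^* n (const c λ _ _ → refl)) λ x y → ℤ.*-comm c _)

form-* : ∀ {n f m h} → Form n f → Form m h → Form (n + m) (λ x y → f x y ℤ.* h x y)
form-* {h = h} (const c e) H = form-ext (form-scale c H) λ x y → cong (ℤ._* h x y) (e x y)
form-* {h = h} (horner {n} {g = g} c F e) H =
  form-ext (form-+ (form-x* (form-* F H)) (form-scale c (form-y^* (suc n) H))) λ x y →
    trans (cong (ℤ._* h x y) (e x y)) (lem (+ x) (g x y) c ((+ y) ℤ.^ suc n) (h x y))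
  where
  lem : ∀ x g c p h → (x ℤ.* g ℤ.+ c ℤ.* p) ℤ.* h ≡ x ℤ.* (g ℤ.* h) ℤ.+ c ℤ.* (p ℤ.* h)
  lem = ℤSolver.solve-∀

shift : ∀ {a} {A : Set a} → (ℕ → ℕ → A) → ℕ → ℕ → A
shift f x y = f (x + y) y

form-shift : ∀ {n f} → Form n f → Form n (shift f)
form-shift (const c e) = const c λ x y → e (x + y) y
form-shift (horner {n} {g = g} c F e) =
  form-ext (form-+ (form-+ (form-x* (form-shift F)) (form-y* (form-shift F))) (form-y^ (suc n) c)) λ x y →
    trans (e (x + y) y) (cong (ℤ._+ c ℤ.* (+ y) ℤ.^ suc n) (ℤ.*-distribʳ-+ (g (x + y) y) (+ x) (+ y)))

-- Product rule for differences: Δ(x g) = x Δg + y `shift g`, while the pure power of `y` drops out.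
-- The degree starts at 1 because the quotient loses one.
form-Δ : ∀ {n f} → Form (suc n) f →
         ∃ λ h → Form n h × (∀ x y → shift f x y ≡ f x y ℤ.+ + y ℤ.* h x y)
form-Δ (horner {f = f} {g = g} c G@(const c′ e′) e) = g , G , λ x y →
  trans (e (x + y) y) (trans (cong (λ z → + (x + y) ℤ.* z ℤ.+ c ℤ.* (+ y) ℤ.^ 1) (trans (e′ (x + y) y) (sym (e′ x y))))
    (trans (lem (+ x) (+ y) (g x y) (c ℤ.* (+ y) ℤ.^ 1)) (cong (ℤ._+ + y ℤ.* g x y) (sym (e x y)))))
  where
  lem : ∀ x y g q → (x ℤ.+ y) ℤ.* g ℤ.+ q ≡ x ℤ.* g ℤ.+ q ℤ.+ y ℤ.* g
  lem = ℤSolver.solve-∀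
form-Δ (horner {suc n} {g = g} c G@(horner _ _ _) e) with form-Δ G
... | h , H , q = (λ x y → + x ℤ.* h x y ℤ.+ shift g x y) , form-+ (form-x* H) (form-shift G) , λ x y →
  trans (e (x + y) y) (trans (lem₁ (+ x) (+ y) (shift g x y) (c ℤ.* (+ y) ℤ.^ suc (suc n)))
   (trans (cong (λ z → + x ℤ.* z ℤ.+ + y ℤ.* shift g x y ℤ.+ c ℤ.* (+ y) ℤ.^ suc (suc n)) (q x y))
    (trans (lem₂ (+ x) (+ y) (shift g x y) (c ℤ.* (+ y) ℤ.^ suc (suc n)) (g x y) (h x y))
      (cong (ℤ._+ + y ℤ.* (+ x ℤ.* h x y ℤ.+ shift g x y)) (sym (e x y))))))
  where
  lem₁ : ∀ x y s q → (x ℤ.+ y) ℤ.* s ℤ.+ q ≡ x ℤ.* s ℤ.+ y ℤ.* s ℤ.+ q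
  lem₁ = ℤSolver.solve-∀
  lem₂ : ∀ x y s q g h → x ℤ.* (g ℤ.+ y ℤ.* h) ℤ.+ y ℤ.* s ℤ.+ q ≡ x ℤ.* g ℤ.+ q ℤ.+ y ℤ.* (x ℤ.* h ℤ.+ s)
  lem₂ = ℤSolver.solve-∀

∣+n^k∣ : ∀ n k → ∣ (+ n) ℤ.^ k ∣ ≡ n ^ k
∣+n^k∣ n zero = refl
∣+n^k∣ n (suc k) = trans (ℤ.abs-* (+ n) ((+ n) ℤ.^ k)) (cong (n *_) (∣+n^k∣ n k))

-- `C` is the sum of the absolute values of the coefficients, hence the same at all points.
form-bound : ∀ {n f} → Form n f → ∃ λ C → ∀ {x y H} → x ≤ H → y ≤ H → ∣ f x y ∣ ≤ C * H ^ n
form-bound (const c e) = ∣ c ∣ , λ {x} {y} _ _ → ≤-reflexive (trans (cong ∣_∣ (e x y)) (sym (*-identityʳ _)))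
form-bound (horner {n} {f} {g} c G e) with form-bound G
... | C , b = C + ∣ c ∣ , bound
  where
  open ≤-Reasoning
  bound : ∀ {x y H} → x ≤ H → y ≤ H → ∣ f x y ∣ ≤ (C + ∣ c ∣) * H ^ suc n
  bound {x} {y} {H} x≤H y≤H = begin
    ∣ f x y ∣                                               ≡⟨ cong ∣_∣ (e x y) ⟩
    ∣ + x ℤ.* g x y ℤ.+ c ℤ.* (+ y) ℤ.^ suc n ∣             ≤⟨ ℤ.∣i+j∣≤∣i∣+∣j∣ (+ x ℤ.* g x y) _ ⟩
    ∣ + x ℤ.* g x y ∣ + ∣ c ℤ.* (+ y) ℤ.^ suc n ∣           ≡⟨ cong₂ _+_ (ℤ.abs-* (+ x) _) (trans (ℤ.abs-* c _) (cong (∣ c ∣ *_) (∣+n^k∣ y (suc n)))) ⟩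
    x * ∣ g x y ∣ + ∣ c ∣ * y ^ suc n                       ≤⟨ +-mono-≤ (*-mono-≤ x≤H (b x≤H y≤H)) (*-monoʳ-≤ ∣ c ∣ (^-monoˡ-≤ (suc n) y≤H)) ⟩
    H * (C * H ^ n) + ∣ c ∣ * H ^ suc n                     ≡⟨ lem H C (H ^ n) ∣ c ∣ ⟩
    (C + ∣ c ∣) * H ^ suc n                                 ∎
    where
    lem : ∀ H C p c → H * (C * p) + c * (H * p) ≡ (C + c) * (H * p)
    lem = ℕSolver.solve-∀

-- The abc identity attached to the terms of a progression

-- A discrete Wronskian: if f(x+y) = f + y b and g(x+y) = g + y h, then w = g b - f h; for constant
-- g, h = 0. It supplies one new factor `y` per step of the recursion behind `evens` and `odds`.
wronskian : ∀ {n g p f} → Form n g → Form (suc p) f →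
            ∃ λ w → Form (n + p) w × (∀ x y → g x y ℤ.* shift f x y ≡ f x y ℤ.* shift g x y ℤ.+ + y ℤ.* w x y)
wronskian {g = g} {f = f} G@(const c e) F with form-Δ F
... | b , B , q = (λ x y → g x y ℤ.* b x y) , form-* G B , λ x y →
  trans (cong₂ ℤ._*_ (trans (e x y) (sym (e (x + y) y))) (q x y))
   (trans (lem (g (x + y) y) (f x y) (+ y) (b x y))
    (cong (λ z → f x y ℤ.* shift g x y ℤ.+ + y ℤ.* (z ℤ.* b x y)) (trans (e (x + y) y) (sym (e x y)))))
  where
  lem : ∀ g f y b → g ℤ.* (f ℤ.+ y ℤ.* b) ≡ f ℤ.* g ℤ.+ y ℤ.* (g ℤ.* b)
  lem = ℤSolver.solve-∀
wronskian {suc n} {g} {p} {f} G@(horner _ _ _) F with form-Δ F | form-Δ G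
... | b , B , q | h , K , q′ =
  (λ x y → g x y ℤ.* b x y ℤ.+ (ℤ.- + 1) ℤ.* (f x y ℤ.* h x y)) ,
  form-+ (form-* G B) (form-scale (ℤ.- + 1) (form-degree (cong suc (+-comm p n)) (form-* F K))) ,
  λ x y → trans (cong (g x y ℤ.*_) (q x y)) (trans (lem (g x y) (f x y) (+ y) (b x y) (h x y))
    (cong (λ z → f x y ℤ.* z ℤ.+ + y ℤ.* (g x y ℤ.* b x y ℤ.+ (ℤ.- + 1) ℤ.* (f x y ℤ.* h x y))) (sym (q′ x y))))
  where
  lem : ∀ g f y b h → g ℤ.* (f ℤ.+ y ℤ.* b)
      ≡ f ℤ.* (g ℤ.+ y ℤ.* h) ℤ.+ y ℤ.* (g ℤ.* b ℤ.+ (ℤ.- + 1) ℤ.* (f ℤ.* h))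
  lem = ℤSolver.solve-∀

termProduct : List ℕ → ℕ → ℕ → ℕ
termProduct js x y = product (map (λ j → x + j * y) js)

termProduct-++ : ∀ is js x y → termProduct (is ++ js) x y ≡ termProduct is x y * termProduct js x y
termProduct-++ is js x y = trans (cong product (map-++ _ is js)) (product-++ (map _ is) (map _ js))

termProduct-suc : ∀ js x y → termProduct (map suc js) x y ≡ shift (termProduct js) x y
termProduct-suc js x y = cong product (trans (sym (map-∘ js)) (map-cong (λ j → sym (+-assoc x y (j * y))) js))

form-termProduct : ∀ js → Form (length js) (λ x y → + termProduct js x y)
form-termProduct [] = const (+ 1) λ _ _ → refl
form-termProduct (j ∷ js) = form-ext
  (form-* (horner {f = λ x y → + (x + j * y)} (+ j) (const (+ 1) λ _ _ → refl) λ x y →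
             trans (cong (λ z → + x ℤ.+ z) (ℤ.pos-* j y)) (lem (+ x) (+ j) (+ y)))
          (form-termProduct js))
  λ x y → ℤ.pos-* (x + j * y) (termProduct js x y)
  where
  lem : ∀ x j y → x ℤ.+ j ℤ.* y ≡ x ℤ.* + 1 ℤ.+ j ℤ.* (y ℤ.* + 1)
  lem = ℤSolver.solve-∀

-- The even and the odd indices below r + 2, the index i with multiplicity C(r+1, i).
evens odds : ℕ → List ℕ
evens zero    = 0 ∷ []
evens (suc r) = evens r ++ map suc (odds r)
odds zero    = 1 ∷ []
odds (suc r) = odds r ++ map suc (evens r)

-- 2^r ∸ (r + 1)
codegree : ℕ → ℕ
codegree zero    = 0
codegree (suc r) = codegree r + (codegree r + r)

length-evens : ∀ r → length (evens r) ≡ suc (codegree r + r)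
length-odds : ∀ r → length (odds r) ≡ suc (codegree r + r)
length-evens zero = refl
length-evens (suc r) = trans (length-++ (evens r))
  (trans (cong₂ _+_ (length-evens r) (trans (length-map suc (odds r)) (length-odds r))) (lem (codegree r) r))
  where
  lem : ∀ e r → suc (e + r) + suc (e + r) ≡ suc (e + (e + r) + suc r)
  lem = ℕSolver.solve-∀
length-odds zero = refl
length-odds (suc r) = trans (length-++ (odds r))
  (trans (cong₂ _+_ (length-odds r) (trans (length-map suc (evens r)) (length-evens r))) (lem (codegree r) r))
  where
  lem : ∀ e r → suc (e + r) + suc (e + r) ≡ suc (e + (e + r) + suc r)
  lem = ℕSolver.solve-∀

-- Induction along Pascal's rule. Writing σ for the shift, the new products are a σb and b σa.
-- Substitute a = b + y^(r+1) g in both: b σb cancels and y^(r+1) (g σb - b σg) remains, whose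
-- bracket is a Wronskian divisible by y.
evens≡odds+y^*cofactor : ∀ r → ∃ λ g → Form (codegree r) g ×
  (∀ x y → + termProduct (evens r) x y ≡ + termProduct (odds r) x y ℤ.+ (+ y) ℤ.^ suc r ℤ.* g x y)
evens≡odds+y^*cofactor zero = (λ _ _ → ℤ.- + 1) , const (ℤ.- + 1) (λ _ _ → refl) , λ x y →
  trans (ℤ.pos-* (x + 0) 1) (trans (lem (+ x) (+ y))
    (cong (ℤ._+ (+ y) ℤ.^ 1 ℤ.* (ℤ.- + 1)) (sym (ℤ.pos-* (x + (y + 0)) 1))))
  where
  lem : ∀ x y → (x ℤ.+ + 0) ℤ.* + 1 ≡ (x ℤ.+ (y ℤ.+ + 0)) ℤ.* + 1 ℤ.+ (y ℤ.* + 1) ℤ.* (ℤ.- + 1)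
  lem = ℤSolver.solve-∀
evens≡odds+y^*cofactor (suc r) with evens≡odds+y^*cofactor r
... | g , G , q with wronskian G (form-degree (length-odds r) (form-termProduct (odds r)))
... | w , W , q′ = w , W , λ x y → begin
  + termProduct (evens r ++ map suc (odds r)) x y
    ≡⟨ cong +_ (trans (termProduct-++ (evens r) _ x y) (cong (a x y *_) (termProduct-suc (odds r) x y))) ⟩
  + (a x y * shift b x y)                       ≡⟨ ℤ.pos-* (a x y) _ ⟩
  + a x y ℤ.* + shift b x y                     ≡⟨ cong (ℤ._* + shift b x y) (q x y) ⟩
  (+ b x y ℤ.+ (+ y) ℤ.^ suc r ℤ.* g x y) ℤ.* + shift b x y
    ≡⟨ lem₁ (+ b x y) ((+ y) ℤ.^ suc r) (g x y) (+ shift b x y) ⟩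
  + b x y ℤ.* + shift b x y ℤ.+ (+ y) ℤ.^ suc r ℤ.* (g x y ℤ.* + shift b x y)
    ≡⟨ cong (λ z → + b x y ℤ.* + shift b x y ℤ.+ (+ y) ℤ.^ suc r ℤ.* z) (q′ x y) ⟩
  + b x y ℤ.* + shift b x y ℤ.+ (+ y) ℤ.^ suc r ℤ.* (+ b x y ℤ.* shift g x y ℤ.+ + y ℤ.* w x y)
    ≡⟨ lem₂ (+ b x y) ((+ y) ℤ.^ suc r) (shift g x y) (+ shift b x y) (+ y) (w x y) ⟩
  + b x y ℤ.* (+ shift b x y ℤ.+ (+ y) ℤ.^ suc r ℤ.* shift g x y) ℤ.+ (+ y) ℤ.^ suc (suc r) ℤ.* w x y
    ≡⟨ cong (λ z → + b x y ℤ.* z ℤ.+ (+ y) ℤ.^ suc (suc r) ℤ.* w x y) (q (x + y) y) ⟨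
  + b x y ℤ.* + shift a x y ℤ.+ (+ y) ℤ.^ suc (suc r) ℤ.* w x y
    ≡⟨ cong (ℤ._+ (+ y) ℤ.^ suc (suc r) ℤ.* w x y) (ℤ.pos-* (b x y) _) ⟨
  + (b x y * shift a x y) ℤ.+ (+ y) ℤ.^ suc (suc r) ℤ.* w x y
    ≡⟨ cong (λ z → + z ℤ.+ (+ y) ℤ.^ suc (suc r) ℤ.* w x y) (trans (termProduct-++ (odds r) _ x y) (cong (b x y *_) (termProduct-suc (evens r) x y))) ⟨
  + termProduct (odds r ++ map suc (evens r)) x y ℤ.+ (+ y) ℤ.^ suc (suc r) ℤ.* w x y ∎
  where
  open ≡-Reasoning
  a b : ℕ → ℕ → ℕ
  a = termProduct (evens r)
  b = termProduct (odds r)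
  lem₁ : ∀ b p g s → (b ℤ.+ p ℤ.* g) ℤ.* s ≡ b ℤ.* s ℤ.+ p ℤ.* (g ℤ.* s)
  lem₁ = ℤSolver.solve-∀
  lem₂ : ∀ b p g s y w → b ℤ.* s ℤ.+ p ℤ.* (b ℤ.* g ℤ.+ y ℤ.* w) ≡ b ℤ.* (s ℤ.+ p ℤ.* g) ℤ.+ (y ℤ.* p) ℤ.* w
  lem₂ = ℤSolver.solve-∀

-- Near coprimality and size of the two products

isEven : ℕ → Bool
isEven zero    = true
isEven (suc n) = not (isEven n)

all-suc : ∀ {b js} → All (λ j → isEven j ≡ b) js → All (λ j → isEven j ≡ not b) (map suc js)
all-suc ps = All.map⁺ (All.map (cong not) ps)

-- Parity keeps the two index lists disjoint and makes every index in `odds` positive.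
evens-even : ∀ r → All (λ j → isEven j ≡ true) (evens r)
odds-odd : ∀ r → All (λ j → isEven j ≡ false) (odds r)
evens-even zero    = refl ∷ []
evens-even (suc r) = All.++⁺ (evens-even r) (all-suc (odds-odd r))
odds-odd zero    = refl ∷ []
odds-odd (suc r) = All.++⁺ (odds-odd r) (all-suc (evens-even r))

evens-< : ∀ r → All (_< 2 + r) (evens r)
odds-< : ∀ r → All (_< 2 + r) (odds r)
evens-< zero    = s≤s z≤n ∷ []
evens-< (suc r) = All.++⁺ (All.map m<n⇒m<1+n (evens-< r)) (All.map⁺ (All.map s≤s (odds-< r)))
odds-< zero    = s≤s (s≤s z≤n) ∷ []
odds-< (suc r) = All.++⁺ (All.map m<n⇒m<1+n (odds-< r)) (All.map⁺ (All.map s≤s (evens-< r)))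

-- The integer l lies in the ideal generated by a and b; unlike a bound for gcd(a, b),
-- this is multiplicative in a and in b.
InIdeal : ℤ → ℕ → ℕ → Set
InIdeal l a b = ∃₂ λ s t → s ℤ.* + a ℤ.+ t ℤ.* + b ≡ l

inIdeal-sym : ∀ {l a b} → InIdeal l a b → InIdeal l b a
inIdeal-sym {a = a} {b} (s , t , e) = t , s , trans (ℤ.+-comm (t ℤ.* + b) (s ℤ.* + a)) e

inIdeal-* : ∀ {l l′ a a′ b} → InIdeal l a b → InIdeal l′ a′ b → InIdeal (l ℤ.* l′) (a * a′) b
inIdeal-* {a = a} {a′} {b} (s , t , e) (s′ , t′ , e′) =
  s ℤ.* s′ , s ℤ.* + a ℤ.* t′ ℤ.+ t ℤ.* (s′ ℤ.* + a′ ℤ.+ t′ ℤ.* + b) ,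
  trans (cong (λ z → s ℤ.* s′ ℤ.* z ℤ.+ (s ℤ.* + a ℤ.* t′ ℤ.+ t ℤ.* (s′ ℤ.* + a′ ℤ.+ t′ ℤ.* + b)) ℤ.* + b) (ℤ.pos-* a a′))
    (trans (lem s t s′ t′ (+ a) (+ a′) (+ b)) (cong₂ ℤ._*_ e e′))
  where
  lem : ∀ s t s′ t′ a a′ b → s ℤ.* s′ ℤ.* (a ℤ.* a′) ℤ.+ (s ℤ.* a ℤ.* t′ ℤ.+ t ℤ.* (s′ ℤ.* a′ ℤ.+ t′ ℤ.* b)) ℤ.* b
                          ≡ (s ℤ.* a ℤ.+ t ℤ.* b) ℤ.* (s′ ℤ.* a′ ℤ.+ t′ ℤ.* b)
  lem = ℤSolver.solve-∀

∣⇒∣inIdeal : ∀ {l a b d} → InIdeal l a b → d ∣ a → d ∣ b → d ∣ ∣ l ∣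
∣⇒∣inIdeal {d = d} (s , t , refl) (divides p refl) (divides q refl) =
  divides ∣ s ℤ.* + p ℤ.+ t ℤ.* + q ∣
    (trans (cong ∣_∣ (trans (cong₂ (λ u v → s ℤ.* u ℤ.+ t ℤ.* v) (ℤ.pos-* p d) (ℤ.pos-* q d)) (lem s t (+ p) (+ q) (+ d))))
           (ℤ.abs-* (s ℤ.* + p ℤ.+ t ℤ.* + q) (+ d)))
  where
  lem : ∀ s t p q d → s ℤ.* (p ℤ.* d) ℤ.+ t ℤ.* (q ℤ.* d) ≡ (s ℤ.* p ℤ.+ t ℤ.* q) ℤ.* d
  lem = ℤSolver.solve-∀

coprime⇒inIdeal : ∀ {x y} → Coprime x y → InIdeal (+ 1) x y
coprime⇒inIdeal {x} {y} c with coprime-Bézout c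
... | Bézout.+- a b e = + a , ℤ.- + b ,
  trans (cong₂ (λ u v → u ℤ.+ (ℤ.- + b) ℤ.* v) (trans (sym (ℤ.pos-* a x)) (trans (cong +_ (sym e)) (cong (λ z → + 1 ℤ.+ z) (ℤ.pos-* b y)))) refl)
        (lem (+ b) (+ y))
  where
  lem : ∀ b y → + 1 ℤ.+ b ℤ.* y ℤ.+ (ℤ.- b) ℤ.* y ≡ + 1
  lem = ℤSolver.solve-∀
... | Bézout.-+ a b e = ℤ.- + a , + b ,
  trans (cong (λ z → (ℤ.- + a) ℤ.* + x ℤ.+ z) (trans (sym (ℤ.pos-* b y)) (trans (cong +_ (sym e)) (cong (λ z → + 1 ℤ.+ z) (ℤ.pos-* a x)))))
        (lem (+ a) (+ x))
  where
  lem : ∀ a x → (ℤ.- a) ℤ.* x ℤ.+ (+ 1 ℤ.+ a ℤ.* x) ≡ + 1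
  lem = ℤSolver.solve-∀

-- Let s x + t y = 1. Add s times j (x + i y) - i (x + j y) = (j - i) x and t times (x + j y) - (x +
-- i y) = (j - i) y.
terms-inIdeal : ∀ i j {x y} → Coprime x y → InIdeal (+ j ℤ.+ ℤ.- + i) (x + i * y) (x + j * y)
terms-inIdeal i j {x} {y} c with coprime⇒inIdeal c
... | s , t , e = s ℤ.* + j ℤ.+ ℤ.- t , t ℤ.+ ℤ.- (s ℤ.* + i) ,
  trans (cong₂ (λ u v → (s ℤ.* + j ℤ.+ ℤ.- t) ℤ.* (+ x ℤ.+ u) ℤ.+ (t ℤ.+ ℤ.- (s ℤ.* + i)) ℤ.* (+ x ℤ.+ v)) (ℤ.pos-* i y) (ℤ.pos-* j y))
   (trans (lem s t (+ x) (+ y) (+ i) (+ j)) (trans (cong (ℤ._* (+ j ℤ.+ ℤ.- + i)) e) (ℤ.*-identityˡ _)))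
  where
  lem : ∀ s t x y i j → (s ℤ.* j ℤ.+ ℤ.- t) ℤ.* (x ℤ.+ i ℤ.* y) ℤ.+ (t ℤ.+ ℤ.- (s ℤ.* i)) ℤ.* (x ℤ.+ j ℤ.* y)
                      ≡ (s ℤ.* x ℤ.+ t ℤ.* y) ℤ.* (j ℤ.+ ℤ.- i)
  lem = ℤSolver.solve-∀

1≤∣*∣ : ∀ {l l′} → 1 ≤ ∣ l ∣ → 1 ≤ ∣ l′ ∣ → 1 ≤ ∣ l ℤ.* l′ ∣
1≤∣*∣ {l} {l′} p q = subst (1 ≤_) (sym (ℤ.abs-* l l′)) (*-mono-≤ p q)

-- `l` is the product of all differences j - i: nonzero because the lists are disjoint, and chosen
-- before `x` and `y`.
termProducts-inIdeal : ∀ is js → All (λ i → All (i ≢_) js) is →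
  ∃ λ l → 1 ≤ ∣ l ∣ × (∀ {x y} → Coprime x y → InIdeal l (termProduct is x y) (termProduct js x y))
termProducts-inIdeal [] js [] = + 1 , s≤s z≤n , λ {x} {y} _ → + 1 , + 0 , cong (λ z → + 1 ℤ.+ z) (ℤ.*-zeroˡ (+ termProduct js x y))
termProducts-inIdeal (i ∷ is) js (ps ∷ pss) with one js ps | termProducts-inIdeal is js pss
  where
  one : ∀ js → All (i ≢_) js →
    ∃ λ l → 1 ≤ ∣ l ∣ × (∀ {x y} → Coprime x y → InIdeal l (x + i * y) (termProduct js x y))
  one [] [] = + 1 , s≤s z≤n , λ {x} {y} _ → + 0 , + 1 , cong (ℤ._+ + 1) (ℤ.*-zeroˡ (+ (x + i * y)))
  one (j ∷ js) (p ∷ ps) with one js ps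
  ... | l , l≥1 , f = (+ j ℤ.+ ℤ.- + i) ℤ.* l , 1≤∣*∣ {+ j ℤ.+ ℤ.- + i} (n≢0⇒n>0 (p ∘ sym ∘ ℤ.+-injective ∘ ℤ.i-j≡0⇒i≡j (+ j) (+ i) ∘ ℤ.∣i∣≡0⇒i≡0)) l≥1 ,
    λ c → inIdeal-sym (inIdeal-* (inIdeal-sym (terms-inIdeal i j c)) (inIdeal-sym (f c)))
... | l , l≥1 , f | l′ , l′≥1 , f′ = l ℤ.* l′ , 1≤∣*∣ {l} {l′} l≥1 l′≥1 , λ c → inIdeal-* (f c) (f′ c)

common-divisor-bound : ∀ r → ∃ λ L → ∀ {x y d} → Coprime x y →
  d ∣ termProduct (evens r) x y → d ∣ termProduct (odds r) x y → d ≤ L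
common-divisor-bound r with termProducts-inIdeal (evens r) (odds r)
  (All.map (λ p → All.map (λ q → λ { refl → absurd (trans (sym p) q) }) (odds-odd r)) (evens-even r))
  where
  absurd : true ≢ false
  absurd ()
... | l , l≥1 , f = ∣ l ∣ , λ c p q → ∣⇒≤ {{>-nonZero l≥1}} (∣⇒∣inIdeal (f c) p q)

prime∣termProduct : ∀ {P : ℕ → Set} {js p x y} → All P js → Prime p → p ∣ termProduct js x y → ∃ λ j → P j × p ∣ x + j * y
prime∣termProduct [] pp p∣1 = ⊥-elim (¬prime[1] (subst Prime (∣1⇒≡1 p∣1) pp))
prime∣termProduct {js = j ∷ js} {x = x} {y} (q ∷ qs) pp p∣ with euclidsLemma (x + j * y) _ pp p∣
... | inj₁ h = j , q , h
... | inj₂ h = prime∣termProduct qs pp h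

termProduct-≥1 : ∀ js {x} y → 1 ≤ x → 1 ≤ termProduct js x y
termProduct-≥1 [] y _ = s≤s z≤n
termProduct-≥1 (j ∷ js) y p = *-mono-≤ (≤-trans p (m≤m+n _ (j * y))) (termProduct-≥1 js y p)

-- For j ≥ 1 the term x + j y is at least x and at least y. Index 0 would give only x, so the lower
-- bound is taken from `odds`.
^≤termProduct : ∀ {js} x y → All (1 ≤_) js → (x ⊔ y) ^ length js ≤ termProduct js x y
^≤termProduct x y [] = s≤s z≤n
^≤termProduct {suc j ∷ js} x y (_ ∷ ps) =
  *-mono-≤ (⊔-lub (m≤m+n x _) (≤-trans (m≤m+n y (j * y)) (m≤n+m _ x))) (^≤termProduct x y ps)

odds-≥1 : ∀ r → All (1 ≤_) (odds r)
odds-≥1 r = All.map (λ { {suc _} _ → s≤s z≤n }) (odds-odd r)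

termProduct-≤ : ∀ js → ∃ λ C → ∀ {x y H} → x ≤ H → y ≤ H → termProduct js x y ≤ C * H ^ length js
termProduct-≤ js = form-bound (form-termProduct js)

-- Applying the abc conjecture

^-distribʳ-* : ∀ m n o → (m * n) ^ o ≡ m ^ o * n ^ o
^-distribʳ-* m n zero = refl
^-distribʳ-* m n (suc o) = trans (cong (m * n *_) (^-distribʳ-* m n o)) (lem m n (m ^ o) (n ^ o))
  where
  lem : ∀ m n p q → m * n * (p * q) ≡ m * p * (n * q)
  lem = ℕSolver.solve-∀

^-monoˡ-∣ : ∀ k {m n} → m ∣ n → m ^ k ∣ n ^ k
^-monoˡ-∣ zero    _ = ∣-refl
^-monoˡ-∣ (suc k) p = *-pres-∣ p (^-monoˡ-∣ k p)

1≤^ : ∀ {m} n → 1 ≤ m → 1 ≤ m ^ n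
1≤^ {m} n p = m^n>0 m {{>-nonZero p}} n

coprime-^ˡ : ∀ {m n} k → Coprime m n → Coprime (m ^ k) n
coprime-^ˡ zero    _ = 1-coprimeTo _
coprime-^ˡ {m} (suc k) c (d∣m*mᵏ , d∣n) =
  coprime-^ˡ k c (coprime-divisor (λ (e∣d , e∣m) → c (e∣m , ∣-trans e∣d d∣n)) d∣m*mᵏ , d∣n)

prime-∤⇒coprime : ∀ {p n} → Prime p → ¬ p ∣ n → Coprime p n
prime-∤⇒coprime pp p∤n (d∣p , d∣n) with prime⇒irreducible pp d∣p
... | inj₁ d≡1  = d≡1
... | inj₂ refl = ⊥-elim (p∤n d∣n)

prime∣^⇒∣ : ∀ {p n} k → Prime p → p ∣ n ^ k → p ∣ n
prime∣^⇒∣ zero pp p∣1 = ⊥-elim (¬prime[1] (subst Prime (∣1⇒≡1 p∣1) pp))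
prime∣^⇒∣ {n = n} (suc k) pp h with euclidsLemma n (n ^ k) pp h
... | inj₁ p∣n = p∣n
... | inj₂ p∣nᵏ = prime∣^⇒∣ k pp p∣nᵏ

prime∤product : ∀ {p qs} → Prime p → All Prime qs → All (p ≢_) qs → ¬ p ∣ product qs
prime∤product pp [] [] p∣1 = ¬prime[1] (subst Prime (∣1⇒≡1 p∣1) pp)
prime∤product {qs = q ∷ qs} pp (pq ∷ pqs) (p≢q ∷ p≢qs) h with euclidsLemma q (product qs) pp h
... | inj₂ p∣qs = prime∤product pp pqs p≢qs p∣qs
... | inj₁ p∣q with prime⇒irreducible pq p∣q
...   | inj₁ refl = ¬prime[1] pp
...   | inj₂ p≡q  = p≢q p≡q

-- Powers of distinct primes are coprime, so their divisibilities into `T` multiply.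
product-^-∣ : ∀ k {T qs} → Unique qs → All Prime qs → All (λ q → q ^ k ∣ T) qs → product qs ^ k ∣ T
product-^-∣ k [] [] [] = subst (_∣ _) (sym (^-zeroˡ k)) (1∣ _)
product-^-∣ k {qs = q ∷ qs} (u ∷ us) (pq ∷ pqs) (h ∷ hs) with product-^-∣ k us pqs hs
... | divides c refl = subst (_∣ c * product qs ^ k) (sym (^-distribʳ-* q (product qs) k))
  (*-monoˡ-∣ (product qs ^ k)
    (coprime-divisor (coprime-^ˡ k (prime-∤⇒coprime pq (prime∤product pq pqs u ∘ prime∣^⇒∣ k pq)))
                     (subst (q ^ k ∣_) (*-comm c _) h)))

Rad-^-∣ : ∀ k n {T} → (∀ p → Prime p → p ∣ n → p ^ k ∣ T) → Rad n ^ k ∣ T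
Rad-^-∣ k n h = product-^-∣ k (Unique.filter⁺ P? (Unique.upTo⁺ (suc n))) (All.map proj₁ ps) (All.map (λ (pp , p∣n) → h _ pp p∣n) ps)
  where
  P? = λ p → prime? p ×-dec (p ∣? n)
  ps = All.all-filter P? (upTo (suc n))

-- `LtCPow` reads its exponents off the normal form, so the sum is exhibited in lowest terms; abc
-- then has the exponents n+1 and n+2.
1+1/[1+n] : ∀ n → 1ℚ +ℚ mkℚ (+ 1) n (1-coprimeTo (suc n))
            ≡ mkℚ (+ suc (suc n)) n (λ {d} c → coprime-+ (1-coprimeTo (suc n)) (subst (d ∣_) (sym (+-comm (suc n) 1)) (proj₁ c) , proj₂ c))
1+1/[1+n] n = ℚ.toℚᵘ-injective (ℚᵘ.≃-trans (ℚ.toℚᵘ-homo-+ 1ℚ (mkℚ (+ 1) n (1-coprimeTo (suc n)))) (ℚᵘ.*≡* (lem (+ suc n))))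
  where
  lem : ∀ s → (+ 1 ℤ.* s ℤ.+ + 1 ℤ.* + 1) ℤ.* s ≡ (+ 1 ℤ.+ s) ℤ.* (+ 1 ℤ.* s)
  lem = ℤSolver.solve-∀

abc-^ : ABC → ∀ n → ∃ λ K → ∀ {a b} → 1 ≤ a → 1 ≤ b → Coprime a b →
        (a + b) ^ suc n ≤ K * Rad (a * b * (a + b)) ^ suc (suc n)
abc-^ abc n with abc (mkℚ (+ 1) n (1-coprimeTo (suc n))) (*<* (subst (+ 0 ℤ.<_) (sym (ℤ.*-identityʳ (+ 1))) (ℤ.+<+ (s≤s z≤n))))
... | K , h = K , λ {a} {b} 1≤a 1≤b c →
  <⇒≤ (subst (_< K * Rad (a * b * (a + b)) ^ suc (suc n)) (*-identityʳ _)
    (subst (LtCPow K (a + b) (Rad (a * b * (a + b)))) (1+1/[1+n] n) (h a b (a + b) 1≤a 1≤b c refl)))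

gcd-decompose : ∀ m n → 1 ≤ m → ∃ λ a → ∃ λ b → m ≡ a * gcd m n × n ≡ b * gcd m n × Coprime a b
gcd-decompose m n 1≤m with gcd[m,n]∣m m n | gcd[m,n]∣n m n
... | divides a e | divides b e′ = a , b , e , e′ , GCD≡1⇒coprime (GCD-* {{g≢0}}
  (subst (λ z → GCD (a * g) (b * g) z) (sym (*-identityˡ g)) (subst (λ z → GCD z (b * g) g) e (subst (λ z → GCD m z g) e′ (gcd-GCD m n)))))
  where
  g = gcd m n
  g≢0 : NonZero g
  g≢0 = ≢-nonZero (gcd[m,n]≢0 m n (inj₁ (λ m≡0 → <-irrefl (sym m≡0) 1≤m)))

1≤factorˡ : ∀ {m} a b → 1 ≤ m → m ≡ a * b → 1 ≤ a
1≤factorˡ zero b p refl = p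
1≤factorˡ (suc a) b p e = s≤s z≤n

-- Division by gcd(x, z) ≤ L restores coprimality at the cost of L^(n+1). The k-th power is taken
-- because Rad^k divides `T`, whose size can be estimated, unlike that of Rad.
abc-non-coprime : ABC → ∀ n L → ∃ λ K → ∀ k {x z T} → 1 ≤ x → 1 ≤ z → 1 ≤ T →
  (∀ d → d ∣ x → d ∣ z → d ≤ L) →
  (∀ p → Prime p → (p ∣ x) ⊎ (p ∣ z) ⊎ (p ∣ x + z) → p ^ k ∣ T) →
  ((x + z) ^ suc n) ^ k ≤ K ^ k * T ^ suc (suc n)
abc-non-coprime abc n L with abc-^ abc n
... | K , h = L ^ suc n * K , bound
  where
  open ≤-Reasoning
  bound : ∀ k {x z T} → 1 ≤ x → 1 ≤ z → 1 ≤ T →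
    (∀ d → d ∣ x → d ∣ z → d ≤ L) →
    (∀ p → Prime p → (p ∣ x) ⊎ (p ∣ z) ⊎ (p ∣ x + z) → p ^ k ∣ T) →
    ((x + z) ^ suc n) ^ k ≤ (L ^ suc n * K) ^ k * T ^ suc (suc n)
  bound k {x} {z} {T} 1≤x 1≤z 1≤T dL hT with gcd-decompose x z 1≤x
  ... | a , b , ex , ez , cop = begin
    ((x + z) ^ suc n) ^ k                        ≡⟨ cong (λ w → (w ^ suc n) ^ k) es ⟩
    (((a + b) * g) ^ suc n) ^ k                  ≡⟨ cong (_^ k) (^-distribʳ-* (a + b) g (suc n)) ⟩
    ((a + b) ^ suc n * g ^ suc n) ^ k            ≤⟨ ^-monoˡ-≤ k (*-mono-≤ (h 1≤a 1≤b cop) (^-monoˡ-≤ (suc n) g≤L)) ⟩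
    (K * R ^ suc (suc n) * L ^ suc n) ^ k        ≡⟨ cong (_^ k) (lem K (R ^ suc (suc n)) (L ^ suc n)) ⟩
    (L ^ suc n * K * R ^ suc (suc n)) ^ k        ≡⟨ ^-distribʳ-* (L ^ suc n * K) _ k ⟩
    (L ^ suc n * K) ^ k * (R ^ suc (suc n)) ^ k  ≡⟨ cong ((L ^ suc n * K) ^ k *_) (trans (^-*-assoc R (suc (suc n)) k)
                                                     (trans (cong (R ^_) (*-comm (suc (suc n)) k)) (sym (^-*-assoc R k (suc (suc n)))))) ⟩
    (L ^ suc n * K) ^ k * (R ^ k) ^ suc (suc n)  ≤⟨ *-monoʳ-≤ ((L ^ suc n * K) ^ k) (^-monoˡ-≤ (suc (suc n)) (∣⇒≤ {{>-nonZero 1≤T}} (Rad-^-∣ k _ hT′))) ⟩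
    (L ^ suc n * K) ^ k * T ^ suc (suc n)        ∎
    where
    g = gcd x z
    R = Rad (a * b * (a + b))
    es : x + z ≡ (a + b) * g
    es = trans (cong₂ _+_ ex ez) (sym (*-distribʳ-+ g a b))
    1≤a = 1≤factorˡ a g 1≤x ex
    1≤b = 1≤factorˡ b g 1≤z ez
    g≤L : g ≤ L
    g≤L = dL g (gcd[m,n]∣m x z) (gcd[m,n]∣n x z)
    a∣x : a ∣ x
    a∣x = subst (a ∣_) (sym ex) (m∣m*n g)
    b∣z : b ∣ z
    b∣z = subst (b ∣_) (sym ez) (m∣m*n g)
    hT′ : ∀ p → Prime p → p ∣ a * b * (a + b) → p ^ k ∣ T
    hT′ p pp p∣ with euclidsLemma (a * b) (a + b) pp p∣
    ... | inj₂ q = hT p pp (inj₂ (inj₂ (∣-trans q (subst (a + b ∣_) (sym es) (m∣m*n g)))))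
    ... | inj₁ q with euclidsLemma a b pp q
    ...   | inj₁ q = hT p pp (inj₁ (∣-trans q a∣x))
    ...   | inj₂ q = hT p pp (inj₂ (inj₁ (∣-trans q b∣z)))
    lem : ∀ K R L → K * R * L ≡ L * K * R
    lem = ℕSolver.solve-∀

-- The progression N, N + d, … in the coordinates N = g x, d = g y.
record FullProgression (k m : ℕ) : Set where
  field
    g x y   : ℕ
    1≤g     : 1 ≤ g
    1≤x     : 1 ≤ x
    1≤y     : 1 ≤ y
    coprime : Coprime x y
    full    : ∀ i → i < m → KFull k (g * (x + i * y))

  height : ℕ
  height = x ⊔ y

coprime-consecutive : ∀ {x y} → Coprime x y → Coprime (x + 0 * y) (x + 1 * y)
coprime-consecutive {x} {y} c (p , q) = c (∣-trans p (∣-reflexive (+-identityʳ x)) ,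
  subst (_ ∣_) (*-identityˡ y) (∣m+n∣m⇒∣n q (∣-trans p (∣-reflexive (+-identityʳ x)))))

module _ {k m} (P : FullProgression k m) (2≤m : 2 ≤ m) where
  open FullProgression P

  -- A prime dividing g misses one of the coprime terms x, x + y, so fullness forces p^k ∣ g.
  prime-^-∣ : ∀ {p j} → Prime p → j < m → p ∣ x + j * y → p ^ k ∣ g * termProduct (upTo m) x y
  prime-^-∣ {p} {j} pp j<m p∣ with p ∣? g
  ... | no p∤g = ∣n⇒∣m*n g (∣-trans
          (coprime-divisor (coprime-^ˡ k (prime-∤⇒coprime pp p∤g)) (full j j<m p pp (∣n⇒∣m*n g p∣)))
          (∈⇒∣product (∈-map⁺ (λ j → x + j * y) (∈-upTo⁺ j<m))))
  ... | yes p∣g = ∣m⇒∣m*n _ (case p ∣? x + 0 * y of λ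
          { (no p∤) → drop 0 (≤-trans (s≤s z≤n) 2≤m) p∤
          ; (yes p∣₀) → drop 1 2≤m λ p∣₁ → ¬prime[1] (subst Prime (coprime-consecutive coprime (p∣₀ , p∣₁)) pp) })
    where
    drop : ∀ i → i < m → ¬ p ∣ x + i * y → p ^ k ∣ g
    drop i i<m p∤ = coprime-divisor (coprime-^ˡ k (prime-∤⇒coprime pp p∤))
      (subst (p ^ k ∣_) (*-comm g _) (full i i<m p pp (∣m⇒∣m*n _ p∣g)))

-- The height of a full progression

difference-abs : ∀ {a b z w} → + a ≡ + b ℤ.+ w → a ≡ b + z ⊎ b ≡ a + z → z ≡ ∣ w ∣
difference-abs {b = b} {z} {w} e (inj₁ refl) = cong ∣_∣ (∙-cancelˡ (+ b) (+ z) w e)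
difference-abs {a} {z = z} {w} e (inj₂ refl) = trans (cong ∣_∣ (inverseˡ-unique (+ z) w
  (∙-cancelˡ (+ a) _ _ (trans (sym (ℤ.+-assoc (+ a) (+ z) w)) (trans (sym e) (sym (ℤ.+-identityʳ (+ a)))))))) (ℤ.∣-i∣≡∣i∣ w)

^-^-comm : ∀ a m n → (a ^ m) ^ n ≡ (a ^ n) ^ m
^-^-comm a m n = trans (^-*-assoc a m n) (trans (cong (a ^_) (*-comm m n)) (sym (^-*-assoc a n m)))

-- `Y` will be the larger of the two products. The cofactor's size (H^E)^k occurs to the power s on
-- the left and s + 1 on the right; after cancelling `Q` one copy is left, free of s.
height-power-bound : ∀ {H p E s Y T C V K} k .{{_ : NonZero H}} →
  H ^ p * H ^ E ≤ Y → T ≤ C * (V * (H ^ E) ^ k) → (Y ^ s) ^ k ≤ K ^ k * T ^ suc s →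
  H ^ (k * p * s) ≤ K ^ k * C ^ suc s * (V ^ suc s * H ^ (k * E))
height-power-bound {H} {p} {E} {s} {Y} {T} {C} {V} {K} k ≤Y T≤ h = *-cancelʳ-≤ _ _ Q {{m^n≢0 _ s {{m^n≢0 _ k {{m^n≢0 H E}}}}}} (begin
  H ^ (k * p * s) * Q
    ≡⟨ cong (_* Q) (trans (cong (λ d → H ^ (d * s)) (*-comm k p))
          (trans (sym (^-*-assoc H (p * k) s)) (cong (_^ s) (sym (^-*-assoc H p k))))) ⟩
  ((H ^ p) ^ k) ^ s * ((H ^ E) ^ k) ^ s
    ≡⟨ trans (sym (^-distribʳ-* _ _ s)) (cong (_^ s) (sym (^-distribʳ-* _ _ k))) ⟩
  ((H ^ p * H ^ E) ^ k) ^ s                ≤⟨ ^-monoˡ-≤ s (^-monoˡ-≤ k ≤Y) ⟩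
  (Y ^ k) ^ s                              ≡⟨ ^-^-comm Y k s ⟩
  (Y ^ s) ^ k                              ≤⟨ h ⟩
  K ^ k * T ^ suc s                        ≤⟨ *-monoʳ-≤ (K ^ k) (^-monoˡ-≤ (suc s) T≤) ⟩
  K ^ k * (C * (V * (H ^ E) ^ k)) ^ suc s
    ≡⟨ cong (K ^ k *_) (trans (^-distribʳ-* C _ (suc s)) (cong (C ^ suc s *_) (^-distribʳ-* V _ (suc s)))) ⟩
  K ^ k * (C ^ suc s * (V ^ suc s * ((H ^ E) ^ k * Q)))
    ≡⟨ lem (K ^ k) (C ^ suc s) (V ^ suc s) ((H ^ E) ^ k) Q ⟩
  K ^ k * C ^ suc s * (V ^ suc s * (H ^ E) ^ k) * Q
    ≡⟨ cong (λ d → K ^ k * C ^ suc s * (V ^ suc s * d) * Q) (trans (^-*-assoc H E k) (cong (H ^_) (*-comm E k))) ⟩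
  K ^ k * C ^ suc s * (V ^ suc s * H ^ (k * E)) * Q ∎)
  where
  open ≤-Reasoning
  Q = ((H ^ E) ^ k) ^ s
  lem : ∀ a c v h q → a * (c * (v * (h * q))) ≡ a * c * (v * h) * q
  lem = ℕSolver.solve-∀

module _ {r k s L C₁ C₂ K₁ : ℕ} {G : ℕ → ℕ → ℤ}
  (L-bound : ∀ {x y d} → Coprime x y → d ∣ termProduct (evens r) x y → d ∣ termProduct (odds r) x y → d ≤ L)
  (A≡B+y^*G : ∀ x y → + termProduct (evens r) x y ≡ + termProduct (odds r) x y ℤ.+ (+ y) ℤ.^ suc r ℤ.* G x y)
  (C₁-bound : ∀ {x y H} → x ≤ H → y ≤ H → termProduct (applyUpTo suc (suc r)) x y ≤ C₁ * H ^ length (applyUpTo suc (suc r)))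
  (C₂-bound : ∀ {x y H} → x ≤ H → y ≤ H → ∣ G x y ∣ ≤ C₂ * H ^ codegree r)
  (abc-bound : ∀ k {x z T} → 1 ≤ x → 1 ≤ z → 1 ≤ T →
    (∀ d → d ∣ x → d ∣ z → d ≤ L) →
    (∀ p → Prime p → (p ∣ x) ⊎ (p ∣ z) ⊎ (p ∣ x + z) → p ^ k ∣ T) →
    ((x + z) ^ s) ^ k ≤ K₁ ^ k * T ^ suc s)
  where
  open ≤-Reasoning

  private
    E = codegree r
    C = C₁ * C₂ ^ k

  module _ (P : FullProgression k (2 + r)) where
    open FullProgression P

    private
      H = height
      A = termProduct (evens r) x y
      B = termProduct (odds r) x y
      U = termProduct (upTo (2 + r)) x y
      γ = ∣ G x y ∣
      -- Through g U, fullness covers the primes of A and B. Nothing is known about y and γ, so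
      -- their product is raised to the power k outright; the exponent of y in y^(r+1) does not
      -- affect the radical.
      T = g * U * (y * γ) ^ k
      V = g * x * H ^ suc r * y ^ k

      x≤H : x ≤ H
      x≤H = m≤m⊔n x y
      y≤H : y ≤ H
      y≤H = m≤n⊔m x y
      1≤H : 1 ≤ H
      1≤H = ≤-trans 1≤x x≤H
      instance
        H≢0 : NonZero H
        H≢0 = >-nonZero 1≤H

      ∣y^*G∣ : ∣ (+ y) ℤ.^ suc r ℤ.* G x y ∣ ≡ y ^ suc r * γ
      ∣y^*G∣ = trans (ℤ.abs-* ((+ y) ℤ.^ suc r) (G x y)) (cong (_* γ) (∣+n^k∣ y (suc r)))

      H^≤B : (H ^ suc r) * H ^ E ≤ B
      H^≤B = subst (_≤ B) (trans (cong (H ^_) (trans (length-odds r) (cong suc (+-comm E r)))) (^-distribˡ-+-* H (suc r) E))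
               (^≤termProduct x y (odds-≥1 r))

      -- The term of index 0 stays as the factor x, which the lower bound for N relies on.
      U≤ : U ≤ x * (C₁ * H ^ suc r)
      U≤ = *-mono-≤ (≤-reflexive (+-identityʳ x))
        (subst (λ d → termProduct (applyUpTo suc (suc r)) x y ≤ C₁ * H ^ d) (length-applyUpTo suc (suc r))
          (C₁-bound x≤H y≤H))

      γ≤ : γ ≤ C₂ * H ^ E
      γ≤ = C₂-bound x≤H y≤H

      T≤ : T ≤ C * (V * (H ^ E) ^ k)
      T≤ = begin
        g * U * (y * γ) ^ k
          ≤⟨ *-mono-≤ (*-monoʳ-≤ g U≤) (^-monoˡ-≤ k (*-monoʳ-≤ y γ≤)) ⟩
        g * (x * (C₁ * H ^ suc r)) * (y * (C₂ * H ^ E)) ^ k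
          ≡⟨ cong (g * (x * (C₁ * H ^ suc r)) *_) (trans (^-distribʳ-* y _ k) (cong (y ^ k *_) (^-distribʳ-* C₂ _ k))) ⟩
        g * (x * (C₁ * H ^ suc r)) * (y ^ k * (C₂ ^ k * (H ^ E) ^ k))
          ≡⟨ lem g x C₁ (H ^ suc r) (y ^ k) (C₂ ^ k) ((H ^ E) ^ k) ⟩
        C * (V * (H ^ E) ^ k) ∎
        where
        lem : ∀ g x c h y d e → g * (x * (c * h)) * (y * (d * e)) ≡ c * d * (g * x * h * y * e)
        lem = ℕSolver.solve-∀

      prime-^-∣T : ∀ {z} → z ≡ y ^ suc r * γ → ∀ p → Prime p → (p ∣ A) ⊎ (p ∣ z) ⊎ (p ∣ B) → p ^ k ∣ T
      prime-^-∣T e p pp (inj₁ p∣A) with prime∣termProduct (evens-< r) pp p∣A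
      ... | j , j<m , p∣ = ∣m⇒∣m*n _ (prime-^-∣ P (s≤s (s≤s z≤n)) pp j<m p∣)
      prime-^-∣T e p pp (inj₂ (inj₂ p∣B)) with prime∣termProduct (odds-< r) pp p∣B
      ... | j , j<m , p∣ = ∣m⇒∣m*n _ (prime-^-∣ P (s≤s (s≤s z≤n)) pp j<m p∣)
      prime-^-∣T refl p pp (inj₂ (inj₁ p∣z)) = ∣n⇒∣m*n (g * U) (^-monoˡ-∣ k
        (case euclidsLemma (y ^ suc r) γ pp p∣z of λ
          { (inj₁ p∣y^) → ∣m⇒∣m*n γ (prime∣^⇒∣ {n = y} (suc r) pp p∣y^)
          ; (inj₂ p∣γ) → ∣n⇒∣m*n y p∣γ }))

      1≤T : 1 ≤ γ → 1 ≤ T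
      1≤T 1≤γ = *-mono-≤ (*-mono-≤ 1≤g (termProduct-≥1 (upTo (2 + r)) y 1≤x)) (1≤^ k (*-mono-≤ 1≤y 1≤γ))

      1≤γ : ∀ {z} → 1 ≤ z → z ≡ y ^ suc r * γ → 1 ≤ γ
      1≤γ 1≤z e = 1≤factorˡ γ (y ^ suc r) 1≤z (trans e (*-comm _ γ))

      conclude : ∀ {Y} → B ≤ Y → (Y ^ s) ^ k ≤ K₁ ^ k * T ^ suc s →
        H ^ (k * suc r * s) ≤ K₁ ^ k * C ^ suc s * (V ^ suc s * H ^ (k * E))
      conclude B≤Y h = height-power-bound {p = suc r} {E = E} {T = T} {C = C} {V = V} k (≤-trans H^≤B B≤Y) T≤ h

    -- The abc triple consists of the smaller product, the difference and the larger product. The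
    -- first summand of the constant serves the case A = B, the second the other two.
    height-bound : H ^ (k * suc r * s) ≤
      (L ^ (k * suc r * s) + K₁ ^ k * C ^ suc s) * (V ^ suc s * H ^ (k * E))
    height-bound with <-cmp A B
    ... | tri< A<B _ _ = ≤-trans (conclude ≤-refl
            (subst (λ w → (w ^ s) ^ k ≤ K₁ ^ k * T ^ suc s) A+z≡B
              (abc-bound k (termProduct-≥1 (evens r) y 1≤x) 1≤z (1≤T (1≤γ 1≤z z≡))
                (λ d d∣A d∣z → L-bound coprime d∣A (subst (d ∣_) A+z≡B (∣m∣n⇒∣m+n d∣A d∣z)))
                (λ { p pp (inj₂ (inj₂ q)) → prime-^-∣T z≡ p pp (inj₂ (inj₂ (subst (p ∣_) A+z≡B q)))
                   ; p pp (inj₁ q) → prime-^-∣T z≡ p pp (inj₁ q)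
                   ; p pp (inj₂ (inj₁ q)) → prime-^-∣T z≡ p pp (inj₂ (inj₁ q)) }))))
            (*-monoˡ-≤ _ (m≤n+m _ (L ^ (k * suc r * s))))
      where
      A+z≡B : A + (B ∸ A) ≡ B
      A+z≡B = m+[n∸m]≡n (<⇒≤ A<B)
      1≤z : 1 ≤ B ∸ A
      1≤z = m<n⇒0<n∸m A<B
      z≡ : B ∸ A ≡ y ^ suc r * γ
      z≡ = trans (difference-abs {w = (+ y) ℤ.^ suc r ℤ.* G x y} (A≡B+y^*G x y) (inj₂ (sym A+z≡B))) ∣y^*G∣
    ... | tri> _ _ B<A = ≤-trans (conclude (<⇒≤ B<A)
            (subst (λ w → (w ^ s) ^ k ≤ K₁ ^ k * T ^ suc s) B+z≡A
              (abc-bound k (termProduct-≥1 (odds r) y 1≤x) 1≤z (1≤T (1≤γ 1≤z z≡))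
                (λ d d∣B d∣z → L-bound coprime (subst (d ∣_) B+z≡A (∣m∣n⇒∣m+n d∣B d∣z)) d∣B)
                (λ { p pp (inj₂ (inj₂ q)) → prime-^-∣T z≡ p pp (inj₁ (subst (p ∣_) B+z≡A q))
                   ; p pp (inj₁ q) → prime-^-∣T z≡ p pp (inj₂ (inj₂ q))
                   ; p pp (inj₂ (inj₁ q)) → prime-^-∣T z≡ p pp (inj₂ (inj₁ q)) }))))
            (*-monoˡ-≤ _ (m≤n+m _ (L ^ (k * suc r * s))))
      where
      B+z≡A : B + (A ∸ B) ≡ A
      B+z≡A = m+[n∸m]≡n (<⇒≤ B<A)
      1≤z : 1 ≤ A ∸ B
      1≤z = m<n⇒0<n∸m B<A
      z≡ : A ∸ B ≡ y ^ suc r * γ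
      z≡ = trans (difference-abs {w = (+ y) ℤ.^ suc r ℤ.* G x y} (A≡B+y^*G x y) (inj₁ (sym B+z≡A))) ∣y^*G∣
    -- There is no abc triple here, but B is itself a common divisor, so H ≤ B ≤ L.
    ... | tri≈ _ A≡B _ = begin
      H ^ (k * suc r * s)       ≤⟨ ^-monoˡ-≤ (k * suc r * s) H≤L ⟩
      L ^ (k * suc r * s)       ≤⟨ m≤m+n _ _ ⟩
      K                             ≤⟨ m≤m*n K _ {{>-nonZero (*-mono-≤ (1≤^ (suc s) 1≤V) (1≤^ (k * E) 1≤H))}} ⟩
      K * (V ^ suc s * H ^ (k * E)) ∎
      where
      K = L ^ (k * suc r * s) + K₁ ^ k * C ^ suc s
      1≤V : 1 ≤ V
      1≤V = *-mono-≤ (*-mono-≤ (*-mono-≤ 1≤g 1≤x) (1≤^ (suc r) 1≤H)) (1≤^ k 1≤y)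
      H≤L : H ≤ L
      H≤L = begin
        H                   ≤⟨ m≤m*n H (H ^ r * H ^ E) {{>-nonZero (*-mono-≤ (1≤^ r 1≤H) (1≤^ E 1≤H))}} ⟩
        H * (H ^ r * H ^ E) ≡⟨ *-assoc H _ _ ⟨
        H ^ suc r * H ^ E   ≤⟨ H^≤B ⟩
        B                   ≤⟨ L-bound coprime (subst (B ∣_) (sym A≡B) ∣-refl) ∣-refl ⟩
        L                   ∎

-- As k * codegree r does not depend on n, this is the estimate with ε of order 1/n.
height-estimate : ABC → ∀ r k n → ∃ λ K → ∀ (P : FullProgression k (2 + r)) → let open FullProgression P in
  height ^ (k * suc r * suc n) ≤ K * ((g * x * height ^ suc r * y ^ k) ^ suc (suc n) * height ^ (k * codegree r))
height-estimate abc r k n =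
  let L , L-bound   = common-divisor-bound r
      G , F , eq    = evens≡odds+y^*cofactor r
      C₁ , C₁-bound = termProduct-≤ (applyUpTo suc (suc r))
      C₂ , C₂-bound = form-bound F
      K₁ , abc-bound = abc-non-coprime abc n L
  in L ^ (k * suc r * suc n) + K₁ ^ k * (C₁ * C₂ ^ k) ^ suc (suc n) ,
     height-bound {k = k} {C₁ = C₁} {C₂ = C₂} {K₁ = K₁} {G = G} L-bound eq C₁-bound C₂-bound abc-bound

-- Lower bounds for the content, the difference and the first term

^-cancelʳ-≤ : ∀ {m n} o .{{_ : NonZero o}} → m ^ o ≤ n ^ o → m ≤ n
^-cancelʳ-≤ o h = ≮⇒≥ λ n<m → <⇒≱ (^-monoˡ-< o n<m) h

-- W ≫ Z^(n/(n+1) - ε) for every ε > 0, with j of order 1/ε.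
Dominates : ∀ {I : Set} → ℕ → (W Z : I → ℕ) → Set
Dominates n W Z = ∃₂ λ F E → ∀ j → ∃ λ K → ∀ i → Z i ^ (n * suc j) ≤ K * (W i ^ (suc n * suc j + F) * Z i ^ E)

-- The gap between q and n/(n+1) absorbs `F` and `E` once j is large; then an s-th root is
-- extracted. For negative q the claim only needs W, Z′ ≥ 1.
dominates-GeCPow : ∀ {I n} {W Z Z′ : I → ℕ} → Dominates n W Z →
  (∀ i → 1 ≤ W i) → (∀ i → 1 ≤ Z′ i) → (∀ i → Z′ i ≤ Z i) →
  ∀ q → ↥ q ℤ.* + suc n ℤ.< + n ℤ.* ↧ q → ∃ λ K → ∀ i → GeCPow K (W i) (Z′ i) q
dominates-GeCPow {W = W} {Z} {Z′} _ W≥1 Z′≥1 Z′≤Z (mkℚ -[1+ a ] b-1 _) _ = 1 , λ i →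
  *-mono-≤ (*-monoʳ-≤ 1 (1≤^ (suc b-1) (W≥1 i))) (1≤^ (suc a) (Z′≥1 i))
dominates-GeCPow {n = n} {W} {Z} {Z′} (F , E , h) W≥1 Z′≥1 Z′≤Z (mkℚ (+ a) b-1 _) a/b<n/[n+1] =
  -- `suc K` in place of `K`: a base of at least 1 is bounded by its s-th power.
  suc K ^ b , λ i → ≤-trans (^-monoˡ-≤ a (Z′≤Z i)) (≤-trans (^-cancelʳ-≤ {Z i ^ a} {suc K ^ b * W i ^ b} s (bound i)) (≤-reflexive (sym (*-identityʳ _))))
  where
  open ≤-Reasoning
  b = suc b-1
  -- In integers, a/b < n/(n+1) reads a (n+1) + 1 ≤ n b. Multiplied by j + 1, the surplus 1 pays for
  -- a F + E b.
  j = a * F + E * b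
  s = suc n * suc j + F
  K = proj₁ (h j)
  a[n+1]<nb : suc (a * suc n) ≤ n * b
  a[n+1]<nb = ℤ.drop‿+<+ (subst₂ ℤ._<_ (sym (ℤ.pos-* a (suc n))) (sym (ℤ.pos-* n b)) a/b<n/[n+1])
  exponent : a * s + E * b ≤ n * suc j * b
  exponent = begin
    a * s + E * b                     ≡⟨ lem₁ a n (suc j) F (E * b) ⟩
    a * suc n * suc j + j             ≤⟨ +-monoʳ-≤ (a * suc n * suc j) (n≤1+n j) ⟩
    a * suc n * suc j + suc j         ≡⟨ +-comm _ (suc j) ⟩
    suc (a * suc n) * suc j           ≤⟨ *-monoˡ-≤ (suc j) a[n+1]<nb ⟩
    n * b * suc j                     ≡⟨ lem₂ n b (suc j) ⟩
    n * suc j * b                     ∎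
    where
    lem₁ : ∀ a n t F e → a * (suc n * t + F) + e ≡ a * suc n * t + (a * F + e)
    lem₁ = ℕSolver.solve-∀
    lem₂ : ∀ n b t → n * b * t ≡ n * t * b
    lem₂ = ℕSolver.solve-∀
  bound : ∀ i → (Z i ^ a) ^ s ≤ (suc K ^ b * W i ^ b) ^ s
  bound i = *-cancelʳ-≤ _ _ (Z i ^ (E * b)) {{>-nonZero (1≤^ (E * b) Z≥1)}} (begin
    (Z i ^ a) ^ s * Z i ^ (E * b)           ≡⟨ cong (_* Z i ^ (E * b)) (^-*-assoc (Z i) a s) ⟩
    Z i ^ (a * s) * Z i ^ (E * b)           ≡⟨ ^-distribˡ-+-* (Z i) (a * s) (E * b) ⟨
    Z i ^ (a * s + E * b)                   ≤⟨ ^-monoʳ-≤ (Z i) {{>-nonZero Z≥1}} exponent ⟩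
    Z i ^ (n * suc j * b)                   ≡⟨ ^-*-assoc (Z i) (n * suc j) b ⟨
    (Z i ^ (n * suc j)) ^ b                 ≤⟨ ^-monoˡ-≤ b (≤-trans (proj₂ (h j) i) (*-monoˡ-≤ _ (n≤1+n K))) ⟩
    (suc K * (W i ^ s * Z i ^ E)) ^ b       ≡⟨ trans (^-distribʳ-* (suc K) (W i ^ s * Z i ^ E) b) (cong (suc K ^ b *_) (^-distribʳ-* (W i ^ s) (Z i ^ E) b)) ⟩
    suc K ^ b * ((W i ^ s) ^ b * (Z i ^ E) ^ b)
      ≡⟨ trans (cong₂ (λ w z → suc K ^ b * (w * z)) (^-^-comm (W i) s b) (^-*-assoc (Z i) E b)) (sym (*-assoc (suc K ^ b) _ _)) ⟩
    suc K ^ b * (W i ^ b) ^ s * Z i ^ (E * b)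
      ≤⟨ *-monoˡ-≤ (Z i ^ (E * b)) (*-monoˡ-≤ ((W i ^ b) ^ s) (m≤m*n (suc K ^ b) ((suc K ^ b) ^ (s ∸ 1)) {{m^n≢0 (suc K ^ b) (s ∸ 1) {{m^n≢0 (suc K) b}}}})) ⟩
    (suc K ^ b) ^ s * (W i ^ b) ^ s * Z i ^ (E * b)
      ≡⟨ cong (_* Z i ^ (E * b)) (^-distribʳ-* (suc K ^ b) (W i ^ b) s) ⟨
    (suc K ^ b * W i ^ b) ^ s * Z i ^ (E * b) ∎)
    where
    Z≥1 : 1 ≤ Z i
    Z≥1 = ≤-trans (Z′≥1 i) (Z′≤Z i)

dominates-zero : ∀ {I} {W Z : I → ℕ} → (∀ i → 1 ≤ W i) → Dominates 0 W Z
dominates-zero W≥1 = 0 , 0 , λ j → 1 , λ i → *-monoʳ-≤ 1 (*-monoˡ-≤ 1 (1≤^ (1 * suc j + 0) (W≥1 i)))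

-- `W′` is the part of `V` that is kept; the rest is at most H^q. Cancelling (H^q)^t turns H^(k p t)
-- into H^(n t), and the factor g^(n t) turns H into g H. The leftover exponent q + e does not
-- depend on t.
rescale-height-bound : ∀ {p k} H g V W′ W K n q F e t .{{_ : NonZero H}} .{{_ : NonZero g}} → k * p ≡ n + q → V ≤ W′ * H ^ q →
  g ^ (n * t) * W′ ^ suc t ≤ W ^ (suc n * t + F) → H ^ (k * p * t) ≤ K * (V ^ suc t * H ^ e) →
  (g * H) ^ (n * t) ≤ K * (W ^ (suc n * t + F) * (g * H) ^ (q + e))
rescale-height-bound {p} {k} H g V W′ W K n q F e t kp≡n+q V≤ gW′≤ h = begin
  (g * H) ^ (n * t)                                       ≡⟨ ^-distribʳ-* g H (n * t) ⟩
  g ^ (n * t) * H ^ (n * t)                               ≤⟨ *-monoʳ-≤ (g ^ (n * t)) H-bound ⟩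
  g ^ (n * t) * (K * (W′ ^ suc t * H ^ (q + e)))          ≡⟨ lem (g ^ (n * t)) K (W′ ^ suc t) (H ^ (q + e)) ⟩
  K * (g ^ (n * t) * W′ ^ suc t * H ^ (q + e))            ≤⟨ *-monoʳ-≤ K (*-mono-≤ gW′≤ (^-monoˡ-≤ (q + e) (m≤n*m H g))) ⟩
  K * (W ^ (suc n * t + F) * (g * H) ^ (q + e))           ∎
  where
  open ≤-Reasoning
  lem : ∀ a K w h → a * (K * (w * h)) ≡ K * (a * w * h)
  lem = ℕSolver.solve-∀
  H-bound : H ^ (n * t) ≤ K * (W′ ^ suc t * H ^ (q + e))
  H-bound = *-cancelʳ-≤ _ _ ((H ^ q) ^ t) {{m^n≢0 _ t {{m^n≢0 H q}}}} (begin
    H ^ (n * t) * (H ^ q) ^ t                             ≡⟨ cong (_* (H ^ q) ^ t) (^-*-assoc H n t) ⟨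
    (H ^ n) ^ t * (H ^ q) ^ t                             ≡⟨ ^-distribʳ-* (H ^ n) (H ^ q) t ⟨
    (H ^ n * H ^ q) ^ t                                   ≡⟨ cong (_^ t) (^-distribˡ-+-* H n q) ⟨
    (H ^ (n + q)) ^ t                                     ≡⟨ trans (cong (λ d → (H ^ d) ^ t) (sym kp≡n+q)) (^-*-assoc H (k * p) t) ⟩
    H ^ (k * p * t)                                       ≤⟨ h ⟩
    K * (V ^ suc t * H ^ e)                               ≤⟨ *-monoʳ-≤ K (*-monoˡ-≤ (H ^ e) (^-monoˡ-≤ (suc t) V≤)) ⟩
    K * ((W′ * H ^ q) ^ suc t * H ^ e)                    ≡⟨ cong (λ w → K * (w * H ^ e)) (^-distribʳ-* W′ (H ^ q) (suc t)) ⟩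
    K * (W′ ^ suc t * (H ^ q * (H ^ q) ^ t) * H ^ e)      ≡⟨ lem₂ K (W′ ^ suc t) (H ^ q) ((H ^ q) ^ t) (H ^ e) ⟩
    K * (W′ ^ suc t * (H ^ q * H ^ e)) * (H ^ q) ^ t      ≡⟨ cong (λ w → K * (W′ ^ suc t * w) * (H ^ q) ^ t) (^-distribˡ-+-* H q e) ⟨
    K * (W′ ^ suc t * H ^ (q + e)) * (H ^ q) ^ t          ∎)
    where
    lem₂ : ∀ K w a b e → K * (w * (a * b) * e) ≡ K * (w * (a * e)) * b
    lem₂ = ℕSolver.solve-∀

module _ (abc : ABC) {r k : ℕ} (p+k≤kp : suc r + k ≤ k * suc r) (2≤k : 2 ≤ k) where

  private
    p = suc r
    constant : ℕ → ℕ
    constant j = proj₁ (height-estimate abc r k j)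

  module _ (P : FullProgression k (2 + r)) where
    open FullProgression P
    scale content difference start : ℕ
    scale      = g * height
    content    = g
    difference = g * y
    start      = g * x

    content≥1 : 1 ≤ content
    content≥1 = 1≤g
    difference≥1 : 1 ≤ difference
    difference≥1 = *-mono-≤ 1≤g 1≤y
    start≥1 : 1 ≤ start
    start≥1 = *-mono-≤ 1≤g 1≤x
    difference≤scale : difference ≤ scale
    difference≤scale = *-monoʳ-≤ g (m≤n⊔m x y)
    start≤scale : start ≤ scale
    start≤scale = *-monoʳ-≤ g (m≤m⊔n x y)

  open ≤-Reasoning hiding (start)

  height≢0 : ∀ {P : FullProgression k (2 + r)} → NonZero (FullProgression.height P)
  height≢0 {P} = >-nonZero (≤-trans 1≤x (m≤m⊔n x y)) where open FullProgression P

  -- Both x and y are replaced by H, which leaves W′ = g.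
  content-dominates : Dominates (k * p ∸ (1 + p + k)) content scale
  content-dominates with 1 + p + k ≤? k * p
  -- The stated exponent has a negative numerator here, and truncated subtraction gives 0.
  ... | no ≰ = subst (λ n → Dominates n content scale) (sym (m≤n⇒m∸n≡0 (<⇒≤ (≰⇒> ≰)))) (dominates-zero content≥1)
  ... | yes ≤kp = 1 , q + k * codegree r , λ j → constant j , λ P → let open FullProgression P in
    rescale-height-bound {p} {k} height g (g * x * height ^ p * y ^ k) g g (constant j) n q 1 (k * codegree r) (suc j) {{height≢0 {P}}} {{>-nonZero 1≤g}} (sym (m∸n+n≡m ≤kp)) (V≤ P)
      (≤-reflexive (trans (sym (^-distribˡ-+-* g (n * suc j) (suc (suc j)))) (cong (g ^_) (lem n (suc j)))))
      (proj₂ (height-estimate abc r k j) P)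
    where
    q = 1 + p + k
    n = k * p ∸ q
    lem : ∀ n t → n * t + suc t ≡ suc n * t + 1
    lem = ℕSolver.solve-∀
    V≤ : ∀ P → let open FullProgression P in g * x * height ^ p * y ^ k ≤ g * height ^ q
    V≤ P = begin
      g * x * height ^ p * y ^ k              ≤⟨ *-mono-≤ (*-monoˡ-≤ (height ^ p) (*-monoʳ-≤ g (m≤m⊔n x y))) (^-monoˡ-≤ k (m≤n⊔m x y)) ⟩
      g * height * height ^ p * height ^ k    ≡⟨ lem′ g height (height ^ p) (height ^ k) ⟩
      g * (height ^ suc p * height ^ k)       ≡⟨ cong (g *_) (^-distribˡ-+-* height (suc p) k) ⟨
      g * height ^ q                          ∎
      where
      open FullProgression P
      lem′ : ∀ g h a b → g * h * a * b ≡ g * (h * a * b)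
      lem′ = ℕSolver.solve-∀

  -- Only x is replaced by H, so W′ = g y^k. The power y^(k (t+1)) fits into (g y)^((n+1) t + k)
  -- because k ≤ n + 1, which is p + k ≤ k p in disguise.
  difference-dominates : Dominates (k * p ∸ (1 + p)) difference scale
  difference-dominates = k , q + k * codegree r , λ j → constant j , λ P → let open FullProgression P in
    rescale-height-bound {p} {k} height g (g * x * height ^ p * y ^ k) (g * y ^ k) (g * y) (constant j) n q k (k * codegree r) (suc j) {{height≢0 {P}}} {{>-nonZero 1≤g}} kp≡n+q (V≤ P) (gW′≤ (suc j) P) (proj₂ (height-estimate abc r k j) P)
    where
    q = 1 + p
    n = k * p ∸ q
    kp≡n+q : k * p ≡ n + q
    kp≡n+q = sym (m∸n+n≡m (≤-trans (subst (suc p ≤_) (+-comm k p) (+-monoˡ-≤ p (≤-trans (s≤s z≤n) 2≤k))) p+k≤kp))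
    k≤1+n : k ≤ suc n
    k≤1+n = +-cancelˡ-≤ p _ _ (≤-trans p+k≤kp (≤-reflexive (trans kp≡n+q (lem n p))))
      where
      lem : ∀ n p → n + (1 + p) ≡ p + suc n
      lem = ℕSolver.solve-∀
    V≤ : ∀ P → let open FullProgression P in g * x * height ^ p * y ^ k ≤ g * y ^ k * height ^ q
    V≤ P = begin
      g * x * height ^ p * y ^ k              ≤⟨ *-monoˡ-≤ (y ^ k) (*-monoˡ-≤ (height ^ p) (*-monoʳ-≤ g (m≤m⊔n x y))) ⟩
      g * height * height ^ p * y ^ k         ≡⟨ lem g height (height ^ p) (y ^ k) ⟩
      g * y ^ k * height ^ q                  ∎
      where
      open FullProgression P
      lem : ∀ g h a b → g * h * a * b ≡ g * b * (h * a)
      lem = ℕSolver.solve-∀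
    gW′≤ : ∀ t (P : FullProgression k (2 + r)) → let open FullProgression P in g ^ (n * t) * (g * y ^ k) ^ suc t ≤ (g * y) ^ (suc n * t + k)
    gW′≤ t P = begin
      g ^ (n * t) * (g * y ^ k) ^ suc t             ≡⟨ cong (g ^ (n * t) *_) (^-distribʳ-* g (y ^ k) (suc t)) ⟩
      g ^ (n * t) * (g ^ suc t * (y ^ k) ^ suc t)   ≡⟨ *-assoc (g ^ (n * t)) _ _ ⟨
      g ^ (n * t) * g ^ suc t * (y ^ k) ^ suc t     ≡⟨ cong₂ _*_ (sym (^-distribˡ-+-* g (n * t) (suc t))) (^-*-assoc y k (suc t)) ⟩
      g ^ (n * t + suc t) * y ^ (k * suc t)         ≤⟨ *-mono-≤ (^-monoʳ-≤ g {{>-nonZero 1≤g}} g-exponent) (^-monoʳ-≤ y {{>-nonZero 1≤y}} y-exponent) ⟩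
      g ^ (suc n * t + k) * y ^ (suc n * t + k)     ≡⟨ ^-distribʳ-* g y (suc n * t + k) ⟨
      (g * y) ^ (suc n * t + k)                     ∎
      where
      open FullProgression P
      g-exponent : n * t + suc t ≤ suc n * t + k
      g-exponent = ≤-trans (≤-reflexive (lem n t)) (+-monoʳ-≤ (suc n * t) (≤-trans (s≤s z≤n) 2≤k))
        where
        lem : ∀ n t → n * t + suc t ≡ suc n * t + 1
        lem = ℕSolver.solve-∀
      y-exponent : k * suc t ≤ suc n * t + k
      y-exponent = ≤-trans (≤-reflexive (trans (*-suc k t) (+-comm k (k * t)))) (+-monoˡ-≤ k (*-monoˡ-≤ t k≤1+n))

  -- Only y^k is replaced by H^k, so W′ = g x, and g^(n t) ≤ (g x)^(n t).
  start-dominates : Dominates (k * p ∸ (p + k)) start scale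
  start-dominates = 1 , q + k * codegree r , λ j → constant j , λ P → let open FullProgression P in
    rescale-height-bound {p} {k} height g (g * x * height ^ p * y ^ k) (g * x) (g * x) (constant j) n q 1 (k * codegree r) (suc j) {{height≢0 {P}}} {{>-nonZero 1≤g}} (sym (m∸n+n≡m p+k≤kp)) (V≤ P) (gW′≤ (suc j) P) (proj₂ (height-estimate abc r k j) P)
    where
    q = p + k
    n = k * p ∸ q
    V≤ : ∀ P → let open FullProgression P in g * x * height ^ p * y ^ k ≤ g * x * height ^ q
    V≤ P = begin
      g * x * height ^ p * y ^ k              ≤⟨ *-monoʳ-≤ (g * x * height ^ p) (^-monoˡ-≤ k (m≤n⊔m x y)) ⟩
      g * x * height ^ p * height ^ k         ≡⟨ *-assoc (g * x) _ _ ⟩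
      g * x * (height ^ p * height ^ k)       ≡⟨ cong (g * x *_) (^-distribˡ-+-* height p k) ⟨
      g * x * height ^ q                      ∎
      where open FullProgression P
    gW′≤ : ∀ t (P : FullProgression k (2 + r)) → let open FullProgression P in g ^ (n * t) * (g * x) ^ suc t ≤ (g * x) ^ (suc n * t + 1)
    gW′≤ t P = begin
      g ^ (n * t) * (g * x) ^ suc t           ≤⟨ *-monoˡ-≤ ((g * x) ^ suc t) (^-monoˡ-≤ (n * t) (m≤m*n g x {{>-nonZero 1≤x}})) ⟩
      (g * x) ^ (n * t) * (g * x) ^ suc t     ≡⟨ ^-distribˡ-+-* (g * x) (n * t) (suc t) ⟨
      (g * x) ^ (n * t + suc t)               ≡⟨ cong ((g * x) ^_) (lem n t) ⟩
      (g * x) ^ (suc n * t + 1)               ∎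
      where
      open FullProgression P
      lem : ∀ n t → n * t + suc t ≡ suc n * t + 1
      lem = ℕSolver.solve-∀

-- Comparison with the exponents of the theorem

toℚᵘ-ℕtoℚ : ∀ n → toℚᵘ (ℕtoℚ n) ℚᵘ.≃ ℚᵘ.mkℚᵘ (+ n) 0
toℚᵘ-ℕtoℚ n = ℚ.toℚᵘ-fromℚᵘ (ℚᵘ.mkℚᵘ (+ n) 0)

ℕtoℚ-+ : ∀ m n → ℕtoℚ (m + n) ≡ ℕtoℚ m +ℚ ℕtoℚ n
ℕtoℚ-+ m n = ℚ.toℚᵘ-injective (ℚᵘ.≃-trans (toℚᵘ-ℕtoℚ (m + n)) (ℚᵘ.≃-sym (ℚᵘ.≃-trans (ℚ.toℚᵘ-homo-+ (ℕtoℚ m) (ℕtoℚ n))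
  (ℚᵘ.≃-trans (ℚᵘ.+-cong (toℚᵘ-ℕtoℚ m) (toℚᵘ-ℕtoℚ n)) (ℚᵘ.*≡* (lem (+ m) (+ n)))))))
  where
  lem : ∀ m n → (m ℤ.* + 1 ℤ.+ n ℤ.* + 1) ℤ.* + 1 ≡ (m ℤ.+ n) ℤ.* (+ 1 ℤ.* + 1)
  lem = ℤSolver.solve-∀

ℕtoℚ-* : ∀ m n → ℕtoℚ (m * n) ≡ ℕtoℚ m *ℚ ℕtoℚ n
ℕtoℚ-* m n = ℚ.toℚᵘ-injective (ℚᵘ.≃-trans (toℚᵘ-ℕtoℚ (m * n)) (ℚᵘ.≃-sym (ℚᵘ.≃-trans (ℚ.toℚᵘ-homo-* (ℕtoℚ m) (ℕtoℚ n))
  (ℚᵘ.≃-trans (ℚᵘ.*-cong (toℚᵘ-ℕtoℚ m) (toℚᵘ-ℕtoℚ n)) (ℚᵘ.*≡* (cong (ℤ._* + 1) (sym (ℤ.pos-* m n))))))))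

ℕtoℚ-nonNeg : ∀ n → ℚ.NonNegative (ℕtoℚ n)
ℕtoℚ-nonNeg n = ℚ.normalize-nonNeg n 1

ℕtoℚ-mono-≤ : ∀ {m n} → m ≤ n → ℕtoℚ m ≤ℚ ℕtoℚ n
ℕtoℚ-mono-≤ {m} {n} m≤n = ℚ.toℚᵘ-cancel-≤ (ℚᵘ.≤-respˡ-≃ (ℚᵘ.≃-sym (toℚᵘ-ℕtoℚ m)) (ℚᵘ.≤-respʳ-≃ (ℚᵘ.≃-sym (toℚᵘ-ℕtoℚ n))
  (ℚᵘ.*≤* (ℤ.*-monoʳ-≤-nonNeg (+ 1) (ℤ.+≤+ m≤n)))))

ℕtoℚ-*-recip : ∀ n → 1 ≤ n → ℕtoℚ n *ℚ recip n ≡ 1ℚ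
ℕtoℚ-*-recip (suc n) _ = ℚ.toℚᵘ-injective (ℚᵘ.≃-trans (ℚ.toℚᵘ-homo-* (ℕtoℚ (suc n)) (recip (suc n)))
  (ℚᵘ.≃-trans (ℚᵘ.*-cong (toℚᵘ-ℕtoℚ (suc n)) (ℚ.toℚᵘ-fromℚᵘ (ℚᵘ.mkℚᵘ (+ 1) n))) (ℚᵘ.*≡* (lem (+ suc n)))))
  where
  lem : ∀ n → n ℤ.* + 1 ℤ.* + 1 ≡ + 1 ℤ.* (+ 1 ℤ.* n)
  lem = ℤSolver.solve-∀

recip-nonNeg : ∀ n → ℚ.NonNegative (recip n)
recip-nonNeg zero    = _
recip-nonNeg (suc n) = ℚ.normalize-nonNeg 1 (suc n)

-- n/(n+1), as mkℚ takes the denominator minus one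
fraction : ℕ → ℚ
fraction n = mkℚ (+ n) n (Coprimality.sym (subst (λ z → Coprime z n) (+-comm n 1) (coprime-+ (1-coprimeTo n))))

[1+n]*fraction : ∀ n → ℕtoℚ (suc n) *ℚ fraction n ≡ ℕtoℚ n
[1+n]*fraction n = ℚ.toℚᵘ-injective (ℚᵘ.≃-trans (ℚ.toℚᵘ-homo-* (ℕtoℚ (suc n)) (fraction n))
  (ℚᵘ.≃-trans (ℚᵘ.*-cong (toℚᵘ-ℕtoℚ (suc n)) (ℚᵘ.≃-refl {toℚᵘ (fraction n)}))
  (ℚᵘ.≃-trans (ℚᵘ.*≡* (lem (+ n))) (ℚᵘ.≃-sym (toℚᵘ-ℕtoℚ n)))))
  where
  lem : ∀ n → (+ 1 ℤ.+ n) ℤ.* n ℤ.* + 1 ≡ n ℤ.* (+ 1 ℤ.* (+ 1 ℤ.+ n))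
  lem = ℤSolver.solve-∀

-- A zero denominator does occur, in `expGcd` for m = 3, k = 2 and s = 1 - 1/3; the default value 0
-- is then below c.
divQ-≤ : ∀ {p q c} → 0ℚ ≤ℚ q → 0ℚ ≤ℚ c → p ≤ℚ c *ℚ q → divQ p q ≤ℚ c
divQ-≤ {q = mkℚ (+ zero) _ _} _ 0≤c _ = 0≤c
divQ-≤ {p} {q@(mkℚ (+ suc _) _ _)} {c} _ _ p≤cq = subst (p *ℚ ℚ.1/ q ≤ℚ_)
  (trans (ℚ.*-assoc c q (ℚ.1/ q)) (trans (cong (c *ℚ_) (ℚ.*-inverseʳ q)) (ℚ.*-identityʳ c)))
  (ℚ.*-monoʳ-≤-nonNeg (ℚ.1/ q) p≤cq)
divQ-≤ {q = mkℚ -[1+ _ ] _ _} (*≤* ())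

ℕtoℚ-pos : ∀ n → ℚ.Positive (ℕtoℚ (suc n))
ℕtoℚ-pos n = ℚ.normalize-pos (suc n) 1

+-cancelʳ-≤ℚ : ∀ r {p q} → p +ℚ r ≤ℚ q +ℚ r → p ≤ℚ q
+-cancelʳ-≤ℚ r {p} {q} h = subst₂ _≤ℚ_ (lem p r) (lem q r) (ℚ.+-monoˡ-≤ (ℚ.- r) h)
  where
  open +-*-Solver
  lem : ∀ p r → p +ℚ r +ℚ ℚ.- r ≡ p
  lem = solve 2 (λ p r → p :+ r :+ (:- r) := p) refl

-- (n+1) p = p + n p ≤ n u + n p = n (p + u) ≤ n q. It is applied with u = 1/k.
divQ-≤-fraction : ∀ {p q u} n → p ≤ℚ ℕtoℚ n *ℚ u → 0ℚ ≤ℚ p +ℚ u → p +ℚ u ≤ℚ q → divQ p q ≤ℚ fraction n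
divQ-≤-fraction {p} {q} {u} n p≤nu 0≤p+u p+u≤q =
  divQ-≤ (ℚ.≤-trans 0≤p+u p+u≤q) (ℚ.nonNegative⁻¹ (fraction n)) (ℚ.*-cancelˡ-≤-pos (ℕtoℚ (suc n)) {{ℕtoℚ-pos n}} (begin
    ℕtoℚ (suc n) *ℚ p                  ≡⟨ trans (cong (_*ℚ p) (ℕtoℚ-+ 1 n)) (lem₁ (ℕtoℚ n) p) ⟩
    p +ℚ ℕtoℚ n *ℚ p                   ≤⟨ ℚ.+-monoˡ-≤ (ℕtoℚ n *ℚ p) p≤nu ⟩
    ℕtoℚ n *ℚ u +ℚ ℕtoℚ n *ℚ p         ≡⟨ lem₂ (ℕtoℚ n) p u ⟩
    ℕtoℚ n *ℚ (p +ℚ u)                 ≤⟨ ℚ.*-monoˡ-≤-nonNeg (ℕtoℚ n) {{ℕtoℚ-nonNeg n}} p+u≤q ⟩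
    ℕtoℚ n *ℚ q                        ≡⟨ cong (_*ℚ q) ([1+n]*fraction n) ⟨
    ℕtoℚ (suc n) *ℚ fraction n *ℚ q    ≡⟨ ℚ.*-assoc (ℕtoℚ (suc n)) (fraction n) q ⟩
    ℕtoℚ (suc n) *ℚ (fraction n *ℚ q)  ∎))
  where
  open ℚ.≤-Reasoning
  open +-*-Solver
  lem₁ : ∀ n p → (ℕtoℚ 1 +ℚ n) *ℚ p ≡ p +ℚ n *ℚ p
  lem₁ = solve 2 (λ n p → (con 1ℚ :+ n) :* p := p :+ n :* p) refl
  lem₂ : ∀ n p u → n *ℚ u +ℚ n *ℚ p ≡ n *ℚ (p +ℚ u)
  lem₂ = solve 3 (λ n p u → n :* u :+ n :* p := n :* (p :+ u)) refl

module _ {k : ℕ} (1≤k : 1 ≤ k) where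
  private
    u = recip k
    ι = ℕtoℚ

    *u-mono : ∀ {a b} → a ≤ b → ι a *ℚ u ≤ℚ ι b *ℚ u
    *u-mono a≤b = ℚ.*-monoʳ-≤-nonNeg u {{recip-nonNeg k}} (ℕtoℚ-mono-≤ a≤b)

    *k*u : ∀ a → ι (a * k) *ℚ u ≡ ι a
    *k*u a = trans (cong (_*ℚ u) (ℕtoℚ-* a k)) (trans (ℚ.*-assoc (ι a) (ι k) u)
      (trans (cong (ι a *ℚ_) (ℕtoℚ-*-recip k 1≤k)) (ℚ.*-identityʳ (ι a))))

    -- The hypothesis divided by k l. It puts the denominator of a stated exponent at least 1/k
    -- above its numerator.
    u+mv≤mu : ∀ {m l} → 1 ≤ l → l + m * k ≤ m * l → u +ℚ ι m *ℚ recip l ≤ℚ ι m *ℚ u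
    u+mv≤mu {m} {l} 1≤l h = subst₂ _≤ℚ_ left right (ℚ.*-monoʳ-≤-nonNeg v {{recip-nonNeg l}} (*u-mono h))
      where
      open +-*-Solver
      v = recip l
      lv≡1 : ι l *ℚ v ≡ 1ℚ
      lv≡1 = ℕtoℚ-*-recip l 1≤l
      left : ι (l + m * k) *ℚ u *ℚ v ≡ u +ℚ ι m *ℚ v
      left = trans (cong (λ z → z *ℚ u *ℚ v) (ℕtoℚ-+ l (m * k)))
        (trans (solve 4 (λ l a u v → (l :+ a) :* u :* v := (l :* v) :* u :+ (a :* u) :* v) refl (ι l) (ι (m * k)) u v)
          (cong₂ _+ℚ_ (trans (cong (_*ℚ u) lv≡1) (ℚ.*-identityˡ u)) (cong (_*ℚ v) (*k*u m))))
      right : ι (m * l) *ℚ u *ℚ v ≡ ι m *ℚ u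
      right = trans (cong (λ z → z *ℚ u *ℚ v) (ℕtoℚ-* m l))
        (trans (solve 4 (λ m l u v → m :* l :* u :* v := (m :* u) :* (l :* v)) refl (ι m) (ι l) u v)
          (trans (cong (ι m *ℚ u *ℚ_) lv≡1) (ℚ.*-identityʳ _)))

  -- Here p and q stand for m(1 - 1/k) + e/k - f and m(1 - 1/l) + e/k - f.
  exponent-≤ : ∀ {m l p q} e f n → 1 ≤ l → l + m * k ≤ m * l →
    m * k + e ≤ n + (m + f * k) → m + f * k ≤ m * k + e + 1 →
    p +ℚ (ι m *ℚ u +ℚ ι f) ≡ ι m +ℚ ι e *ℚ u → q +ℚ ι m *ℚ recip l ≡ p +ℚ ι m *ℚ u →
    divQ p q ≤ℚ fraction n
  exponent-≤ {m} {l} {p} {q} e f n 1≤l l+mk≤ml h₁ h₂ p-eq q-eq = divQ-≤-fraction {p} {q} {u} n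
    (+-cancelʳ-≤ℚ (ι m *ℚ u +ℚ ι f) {p} {ι n *ℚ u} (subst₂ _≤ℚ_ eq₁ (eq₂ n) (*u-mono h₁)))
    (+-cancelʳ-≤ℚ (ι m *ℚ u +ℚ ι f) {0ℚ} {p +ℚ u} (subst₂ _≤ℚ_ eq₃ eq₄ (*u-mono h₂)))
    (+-cancelʳ-≤ℚ (ι m *ℚ recip l) {p +ℚ u} {q} (subst₂ _≤ℚ_ (solve 3 (λ p u v → p :+ (u :+ v) := p :+ u :+ v) refl p u (ι m *ℚ recip l))
      (sym q-eq) (ℚ.+-monoʳ-≤ p (u+mv≤mu {m} {l} 1≤l l+mk≤ml))))
    where
    open +-*-Solver
    distrib : ∀ a b → ι (a + b) *ℚ u ≡ ι a *ℚ u +ℚ ι b *ℚ u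
    distrib a b = trans (cong (_*ℚ u) (ℕtoℚ-+ a b)) (ℚ.*-distribʳ-+ u (ι a) (ι b))
    m+fk : ι (m + f * k) *ℚ u ≡ ι m *ℚ u +ℚ ι f
    m+fk = trans (distrib m (f * k)) (cong (ι m *ℚ u +ℚ_) (*k*u f))
    eq₁ : ι (m * k + e) *ℚ u ≡ p +ℚ (ι m *ℚ u +ℚ ι f)
    eq₁ = trans (distrib (m * k) e) (trans (cong (_+ℚ ι e *ℚ u) (*k*u m)) (sym p-eq))
    eq₂ : ∀ n → ι (n + (m + f * k)) *ℚ u ≡ ι n *ℚ u +ℚ (ι m *ℚ u +ℚ ι f)
    eq₂ n = trans (distrib n (m + f * k)) (cong (ι n *ℚ u +ℚ_) m+fk)
    eq₃ : ι (m + f * k) *ℚ u ≡ 0ℚ +ℚ (ι m *ℚ u +ℚ ι f)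
    eq₃ = trans m+fk (sym (ℚ.+-identityˡ _))
    eq₄ : ι (m * k + e + 1) *ℚ u ≡ p +ℚ u +ℚ (ι m *ℚ u +ℚ ι f)
    eq₄ = trans (distrib (m * k + e) 1) (trans (cong₂ _+ℚ_ eq₁ (ℚ.*-identityˡ u))
      (solve 3 (λ p u w → p :+ w :+ u := p :+ u :+ w) refl p u (ι m *ℚ u +ℚ ι f)))

module _ {m k l : ℕ} (1≤k : 1 ≤ k) (1≤l : 1 ≤ l) (l+mk≤ml : l + m * k ≤ m * l) where
  open +-*-Solver
  private
    ι = ℕtoℚ
    u = recip k
    v = recip l
    s = 1ℚ -ℚ v

  expGcd-≤ : ∀ n → m * k ≤ n + (m + 2 * k) → m + 2 * k ≤ m * k + 1 → expGcd s k m ≤ℚ fraction n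
  expGcd-≤ n h₁ h₂ = exponent-≤ 1≤k {m} {l} {ι m *ℚ (1ℚ -ℚ u) -ℚ ι 2} {ι m *ℚ s -ℚ ι 2} 0 2 n 1≤l l+mk≤ml
    (subst (_≤ n + (m + 2 * k)) (sym (+-identityʳ (m * k))) h₁)
    (subst (λ e → m + 2 * k ≤ e + 1) (sym (+-identityʳ (m * k))) h₂)
    (solve 2 (λ m u → m :* (con 1ℚ :- u) :- con (ι 2) :+ (m :* u :+ con (ι 2)) := m :+ con 0ℚ :* u) refl (ι m) u)
    (solve 3 (λ m u v → m :* (con 1ℚ :- v) :- con (ι 2) :+ m :* v := m :* (con 1ℚ :- u) :- con (ι 2) :+ m :* u) refl (ι m) u v)

  expD-≤ : ∀ n → m * k ≤ n + (m + 1 * k) → m + 1 * k ≤ m * k + 1 → expD s k m ≤ℚ fraction n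
  expD-≤ n h₁ h₂ = exponent-≤ 1≤k {m} {l} {ι m *ℚ (1ℚ -ℚ u) -ℚ 1ℚ} {ι m *ℚ s -ℚ 1ℚ} 0 1 n 1≤l l+mk≤ml
    (subst (_≤ n + (m + 1 * k)) (sym (+-identityʳ (m * k))) h₁)
    (subst (λ e → m + 1 * k ≤ e + 1) (sym (+-identityʳ (m * k))) h₂)
    (solve 2 (λ m u → m :* (con 1ℚ :- u) :- con 1ℚ :+ (m :* u :+ con 1ℚ) := m :+ con 0ℚ :* u) refl (ι m) u)
    (solve 3 (λ m u v → m :* (con 1ℚ :- v) :- con 1ℚ :+ m :* v := m :* (con 1ℚ :- u) :- con 1ℚ :+ m :* u) refl (ι m) u v)

  expN-≤ : ∀ n → m * k + 1 ≤ n + (m + 2 * k) → m + 2 * k ≤ m * k + 1 + 1 → expN s k m ≤ℚ fraction n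
  expN-≤ n h₁ h₂ = exponent-≤ 1≤k {m} {l} {ι m *ℚ (1ℚ -ℚ u) +ℚ u -ℚ ι 2} {ι m *ℚ s +ℚ u -ℚ ι 2} 1 2 n 1≤l l+mk≤ml
    h₁ h₂
    (solve 2 (λ m u → m :* (con 1ℚ :- u) :+ u :- con (ι 2) :+ (m :* u :+ con (ι 2)) := m :+ con 1ℚ :* u) refl (ι m) u)
    (solve 3 (λ m u v → m :* (con 1ℚ :- v) :+ u :- con (ι 2) :+ m :* v := m :* (con 1ℚ :- u) :+ u :- con (ι 2) :+ m :* u) refl (ι m) u v)

-- Return from the coordinates to N and d

minus-ε< : ∀ {e c ε} → 0ℚ <ℚ ε → e ≤ℚ c → e -ℚ ε <ℚ c
minus-ε< {e} {ε = ε} 0<ε e≤c = ℚ.<-≤-trans (subst (e -ℚ ε <ℚ_) (ℚ.+-identityʳ e) (ℚ.+-monoʳ-< e (ℚ.neg-antimono-< 0<ε))) e≤c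

GeCPow-mono : ∀ {K K′} x y q → K ≤ K′ → GeCPow K x y q → GeCPow K′ x y q
GeCPow-mono x y q K≤K′ h = ≤-trans h (*-monoˡ-≤ (y ^ negPart (↥ q)) (*-monoˡ-≤ (x ^ ℚ.↧ₙ q) K≤K′))

FullTerms : ℕ → ℕ → ℕ → ℕ → Set
FullTerms k m N d = (i : ℕ) → i < m → KFull k (N + i * d)

fullProgression : ∀ {k m N d} → 1 ≤ N → 1 ≤ d → FullTerms k m N d →
  ∃ λ (P : FullProgression k m) → let open FullProgression P in gcd d N ≡ g × g * x ≡ N × g * y ≡ d
fullProgression {k} {N = N} {d} 1≤N 1≤d full with gcd-decompose d N 1≤d
... | y , x , d≡ , N≡ , cop = record
  { g = g ; x = x ; y = y
  ; 1≤g = 1≤factorˡ g y 1≤d (trans d≡ (*-comm y g))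
  ; 1≤x = 1≤factorˡ x g 1≤N N≡
  ; 1≤y = 1≤factorˡ y g 1≤d d≡
  ; coprime = Coprimality.sym cop
  ; full = λ i i<m → subst (KFull k) (trans (cong₂ (λ a b → a + i * b) N≡ d≡) (lem x g i y)) (full i i<m)
  } , refl , trans (*-comm g x) (sym N≡) , trans (*-comm g y) (sym d≡)
  where
  g = gcd d N
  lem : ∀ x g i y → x * g + i * (y * g) ≡ g * (x + i * y)
  lem = ℕSolver.solve-∀

-- `Bounds` has one constant for three inequalities; the sum of the three constants serves, as
-- `GeCPow` is monotone in it.
bounds-from-coordinates : ∀ {k m} q₁ q₂ q₃ → let open FullProgression {k} {m} in
  (∃ λ K → ∀ P → GeCPow K (g P) (g P * height P) q₁) →
  (∃ λ K → ∀ P → GeCPow K (g P * y P) (g P * x P) q₂) →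
  (∃ λ K → ∀ P → GeCPow K (g P * x P) (g P * y P) q₃) →
  ∃ λ K → ∀ N d → 1 ≤ N → 1 ≤ d → FullTerms k m N d →
    GeCPow K (gcd d N) (d ⊔ N) q₁ × GeCPow K d N q₂ × GeCPow K N d q₃
bounds-from-coordinates q₁ q₂ q₃ (K₁ , h₁) (K₂ , h₂) (K₃ , h₃) = K₁ + (K₂ + K₃) , λ N d 1≤N 1≤d full →
  let P , g≡ , N≡ , d≡ = fullProgression 1≤N 1≤d full
      open FullProgression P
  in GeCPow-mono {K₁} (gcd d N) (d ⊔ N) q₁ (m≤m+n K₁ (K₂ + K₃))
       (subst₂ (λ x y → GeCPow K₁ x y q₁) (sym g≡)
         (trans (*-distribˡ-⊔ g x y) (trans (cong₂ _⊔_ N≡ d≡) (⊔-comm N d))) (h₁ P)) ,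
     GeCPow-mono {K₂} d N q₂ (≤-trans (m≤m+n K₂ K₃) (m≤n+m _ K₁))
       (subst₂ (λ x y → GeCPow K₂ x y q₂) d≡ N≡ (h₂ P)) ,
     GeCPow-mono {K₃} N d q₃ (≤-trans (m≤n+m K₃ K₂) (m≤n+m _ K₁))
       (subst₂ (λ x y → GeCPow K₃ x y q₃) N≡ d≡ (h₃ P))

-- The two halves of the theorem differ only in l, which is k^2 or 2 k - 1; the condition on l is
-- all that the comparison of exponents asks of it.
bounds : ABC → ∀ r k l → let p = suc r ; m = suc p in 2 ≤ k → p + k ≤ k * p → 1 ≤ l → l + m * k ≤ m * l →
  ∀ ε → 0ℚ <ℚ ε →
  ∃ λ K → ∀ N d → 1 ≤ N → 1 ≤ d → FullTerms k m N d → Bounds (1ℚ -ℚ recip l) k m ε K N d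
bounds abc r k l 2≤k p+k≤kp 1≤l l+mk≤ml ε 0<ε = bounds-from-coordinates (expGcd s k m -ℚ ε) (expD s k m -ℚ ε) (expN s k m -ℚ ε) boundᵍ boundᵈ boundᴺ
  where
  p = suc r
  m = suc p
  s = 1ℚ -ℚ recip l
  1≤k : 1 ≤ k
  1≤k = ≤-trans (s≤s z≤n) 2≤k

  nᵍ nᵈ nᴺ : ℕ
  nᵍ = k * p ∸ (1 + p + k)
  nᵈ = k * p ∸ (1 + p)
  nᴺ = k * p ∸ (p + k)

  mk≡kp+k : m * k ≡ k * p + k
  mk≡kp+k = lem k p
    where
    lem : ∀ k p → suc p * k ≡ k * p + k
    lem = ℕSolver.solve-∀

  -- Divided by k: the numerator of `expGcd` is at least -1/k, so its denominator is not negative.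
  -- The other two exponents inherit this.
  m+2k≤mk+1 : m + 2 * k ≤ m * k + 1
  m+2k≤mk+1 = begin
    m + 2 * k          ≡⟨ lem p k ⟩
    p + k + k + 1      ≤⟨ +-monoˡ-≤ 1 (+-monoˡ-≤ k p+k≤kp) ⟩
    k * p + k + 1      ≡⟨ cong (_+ 1) mk≡kp+k ⟨
    m * k + 1          ∎
    where
    open ≤-Reasoning
    lem : ∀ p k → 1 + p + 2 * k ≡ p + k + k + 1
    lem = ℕSolver.solve-∀

  expGcd≤ : expGcd s k m ≤ℚ fraction nᵍ
  expGcd≤ = expGcd-≤ {m} {k} {l} 1≤k 1≤l l+mk≤ml nᵍ (begin
    m * k                         ≡⟨ mk≡kp+k ⟩
    k * p + k                     ≤⟨ +-monoˡ-≤ k (m≤n+m∸n (k * p) (1 + p + k)) ⟩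
    (1 + p + k) + nᵍ + k          ≡⟨ lem nᵍ p k ⟩
    nᵍ + (m + 2 * k)              ∎) m+2k≤mk+1
    where
    open ≤-Reasoning
    lem : ∀ n p k → (1 + p + k) + n + k ≡ n + (1 + p + 2 * k)
    lem = ℕSolver.solve-∀

  expD≤ : expD s k m ≤ℚ fraction nᵈ
  expD≤ = expD-≤ {m} {k} {l} 1≤k 1≤l l+mk≤ml nᵈ (begin
    m * k                         ≡⟨ mk≡kp+k ⟩
    k * p + k                     ≤⟨ +-monoˡ-≤ k (m≤n+m∸n (k * p) (1 + p)) ⟩
    (1 + p) + nᵈ + k              ≡⟨ lem nᵈ p k ⟩
    nᵈ + (m + 1 * k)              ∎) (≤-trans (+-monoʳ-≤ m (*-monoˡ-≤ k (n≤1+n 1))) m+2k≤mk+1)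
    where
    open ≤-Reasoning
    lem : ∀ n p k → (1 + p) + n + k ≡ n + (1 + p + 1 * k)
    lem = ℕSolver.solve-∀

  expN≤ : expN s k m ≤ℚ fraction nᴺ
  expN≤ = expN-≤ {m} {k} {l} 1≤k 1≤l l+mk≤ml nᴺ (begin
    m * k + 1                     ≡⟨ cong (_+ 1) mk≡kp+k ⟩
    k * p + k + 1                 ≤⟨ +-monoˡ-≤ 1 (+-monoˡ-≤ k (m≤n+m∸n (k * p) (p + k))) ⟩
    (p + k) + nᴺ + k + 1          ≡⟨ lem nᴺ p k ⟩
    nᴺ + (m + 2 * k)              ∎) (≤-trans m+2k≤mk+1 (m≤m+n (m * k + 1) 1))
    where
    open ≤-Reasoning
    lem : ∀ n p k → (p + k) + n + k + 1 ≡ n + (1 + p + 2 * k)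
    lem = ℕSolver.solve-∀

  module W = FullProgression {k} {m}

  boundᵍ : ∃ λ K → ∀ P → GeCPow K (W.g P) (scale abc p+k≤kp 2≤k P) (expGcd s k m -ℚ ε)
  boundᵍ = dominates-GeCPow {n = nᵍ} (content-dominates abc p+k≤kp 2≤k) W.1≤g
    (λ P → ≤-trans (start≥1 abc p+k≤kp 2≤k P) (start≤scale abc p+k≤kp 2≤k P)) (λ _ → ≤-refl) (expGcd s k m -ℚ ε)
    (ℚ.drop-*<* (minus-ε< 0<ε expGcd≤))
  boundᵈ : ∃ λ K → ∀ P → GeCPow K (W.g P * W.y P) (W.g P * W.x P) (expD s k m -ℚ ε)
  boundᵈ = dominates-GeCPow {n = nᵈ} (difference-dominates abc p+k≤kp 2≤k) (difference≥1 abc p+k≤kp 2≤k)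
    (start≥1 abc p+k≤kp 2≤k) (start≤scale abc p+k≤kp 2≤k) (expD s k m -ℚ ε) (ℚ.drop-*<* (minus-ε< 0<ε expD≤))
  boundᴺ : ∃ λ K → ∀ P → GeCPow K (W.g P * W.x P) (W.g P * W.y P) (expN s k m -ℚ ε)
  boundᴺ = dominates-GeCPow {n = nᴺ} (start-dominates abc p+k≤kp 2≤k) (start≥1 abc p+k≤kp 2≤k)
    (difference≥1 abc p+k≤kp 2≤k) (difference≤scale abc p+k≤kp 2≤k) (expN s k m -ℚ ε) (ℚ.drop-*<* (minus-ε< 0<ε expN≤))

theorem1 : ABC → (m k : ℕ) → 3 ≤ m → 2 ≤ k → (ε : ℚ) → 0ℚ <ℚ ε →
    (∃ λ (K : ℕ) → (N d : ℕ) → 1 ≤ N → 1 ≤ d →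
    ((i : ℕ) → i < m → KFull k (N + i * d)) → Bounds (s₁ k) k m ε K N d)
    × (2 * k ∸ 1 ≤ m →
    ∃ λ (K : ℕ) → (N d : ℕ) → 1 ≤ N → 1 ≤ d →
    ((i : ℕ) → i < m → KFull k (N + i * d)) → Bounds (s₂ k) k m ε K N d)
-- With m = 3 + a and k = 2 + b, each inequality has a difference of sides that is a polynomial in a
-- and b with nonnegative coefficients, written out in `lem`, `lem₁` and `lem₂`.
theorem1 abc (suc (suc (suc a))) (suc (suc b)) (s≤s (s≤s (s≤s z≤n))) (s≤s (s≤s z≤n)) ε 0<ε =
  bounds abc (suc a) (2 + b) ((2 + b) * (2 + b)) (s≤s (s≤s z≤n)) p+k≤kp (s≤s z≤n) (≤-trans (m≤m+n _ _) (≤-reflexive (lem₁ a b))) ε 0<ε ,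
  -- `suc (b + suc (suc b))` is what k + k - 1 reduces to.
  λ _ → bounds abc (suc a) (2 + b) (suc (b + suc (suc b))) (s≤s (s≤s z≤n)) p+k≤kp (s≤s z≤n) (≤-trans (m≤m+n _ _) (≤-reflexive (lem₂ a b))) ε 0<ε
  where
  p+k≤kp : (2 + a) + (2 + b) ≤ (2 + b) * (2 + a)
  p+k≤kp = ≤-trans (m≤m+n _ (a + b + a * b)) (≤-reflexive (lem a b))
    where
    lem : ∀ a b → (2 + a) + (2 + b) + (a + b + a * b) ≡ (2 + b) * (2 + a)
    lem = ℕSolver.solve-∀
  lem₁ : ∀ a b → (2 + b) * (2 + b) + (3 + a) * (2 + b) + (a * b * b + 3 * a * b + 2 * a + 2 * b * b + 5 * b + 2) ≡ (3 + a) * ((2 + b) * (2 + b))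
  lem₁ = ℕSolver.solve-∀
  lem₂ : ∀ a b → suc (b + suc (suc b)) + (3 + a) * (2 + b) + (a * b + a + b) ≡ (3 + a) * suc (b + suc (suc b))
  lem₂ = ℕSolver.solve-∀
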